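{- Let $n=\prod_{i=1}^s p_i^{\alpha_i}$, where $s\ge 1$, $p_1,\dots,p_s$ are distinct primes and $\alpha_1,\dots,\alpha_s\ge 1$. Then $$\mathcal{Z}_{(\mathcal{U}_n,\mathbb{Z}_n)}=\mathcal{Z}_{(\mathcal{U}_{p_1^{\alpha_1}},\mathbb{Z}_{p_1^{\alpha_1}})}\circledast \mathcal{Z}_{(\mathcal{U}_{p_2^{\alpha_2}},\mathbb{Z}_{p_2^{\alpha_2}})}\circledast\cdots\circledast \mathcal{Z}_{(\mathcal{U}_{p_s^{\alpha_s}},\mathbb{Z}_{p_s^{\alpha_s}})}.$$
   Context: $\mathbb{Z}_n$ is the set of residues modulo $n$. $\mathcal{U}_n=\mathrm{Aut}(\mathbb{Z}_n)$ is identified with the set of residues $a$ modulo $n$ with $\gcd(a,n)=1$, where $a$ corresponds to the map $\pi_a(x)=ax \pmod n$; it acts on the $n$ points of $\mathbb{Z}_n$ by multiplication. For a permutation $\pi$ of a finite set with $N$ elements, $\mathrm{ctype}(\pi)=\prod_{i=1}^N x_i^{\lambda_i(\pi)}$, where $x_1,x_2,\dots$ are formal indeterminates and $\lambda_i(\pi)$ is the number of cycles of length $i$ (fixed points counted as cycles of length 1) in the disjoint cycle decomposition of $\pi$. The cycle index of a finite permutation group $G$ on a finite set $P$ is $\mathcal{Z}_{(G,P)}=\frac{1}{|G|}\sum_{\pi\in G}\mathrm{ctype}(\pi)$. The product operator $\circledast$ on polynomials is defined as follows. For $P(x_1,\dots,x_u)=\sum a_{i_1i_2\ldots i_u}x_1^{i_1}x_2^{i_2}\cdots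 x_u^{i_u}$ and $Q(x_1,\dots,x_v)=\sum b_{j_1j_2\ldots j_v}x_1^{j_1}x_2^{j_2}\cdots x_v^{j_v}$, $$P\circledast Q=\sum a_{i_1i_2\ldots i_u}b_{j_1j_2\ldots j_v}\prod_{\substack{1\le l\le u\\ 1\le m\le v}}\left(x_l^{i_l}\circledast x_m^{j_m}\right),\qquad x_l^{i_l}\circledast x_m^{j_m}=x_{\mathrm{lcm}(l,m)}^{\,i_l j_m\gcd(l,m)},$$ the sum being over all pairs of a monomial of $P$ and a monomial of $Q$. Iterated products are evaluated from left to right. -}

module Defs where

open import Data.Nat.Base
open import Data.Nat.Properties using (*-comm; *-assoc; *-identityʳ; *-identityˡ; +-suc; *-distribˡ-+; +-comm; m*n≢0; m*n≢0⇒n≢0; m^n≢0)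
import Data.Nat.Properties as ℕ
open import Data.Nat.Divisibility using (_∣_; ∣n⇒∣m*n; ∣1⇒≡1; ∣n∣m%n⇒∣m; %-presˡ-∣)
open import Data.Nat.DivMod
open import Data.Nat.GCD using (gcd; module Bézout)
open import Data.Nat.LCM using (lcm; gcd*lcm)
open import Data.Nat.Coprimality using (gcd≡1⇒coprime; coprime⇒gcd≡1; coprime-Bézout)
open import Data.Nat.Primality using (Prime; prime⇒nonZero)
open import Data.Integer.Base using (+_)
open import Data.Rational.Base as ℚ using (ℚ; 0ℚ)
open import Data.Fin.Base using (Fin; toℕ)
open import Data.Fin.Properties as Fin using (toℕ-fromℕ<; toℕ-injective; toℕ<n)
open import Data.Fin.Permutation using (Permutation′; permutation; _⟨$⟩ʳ_; _⟨$⟩ˡ_; _∘ₚ_; flip)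
import Data.Fin.Permutation as Perm
open import Data.List.Base hiding (product)
open import Data.List.Relation.Unary.All as All using (All; []; _∷_; all?)
open import Data.List.Relation.Unary.All.Properties using (all-filter)
open import Data.List.Relation.Unary.Any using (Any; here; there)
open import Data.List.Relation.Unary.AllPairs using ([]; _∷_)
open import Data.List.Membership.Propositional using (_∈_)
open import Data.List.Membership.Propositional.Properties using (∈-filter⁺; ∈-allFin)
import Data.List.Membership.Setoid as SetoidMembership
import Data.List.Relation.Unary.Unique.Setoid as SetoidUnique
open import Data.List.Relation.Unary.Unique.Propositional using (Unique)
import Data.List.Relation.Unary.Unique.Propositional.Properties as Unique
open import Data.Product.Base using (_×_; _,_; ∃; ∃-syntax; Σ-syntax; proj₁; proj₂)
open import Level using (0ℓ)
open import Relation.Binary.Bundles using (Setoid)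
open import Relation.Binary.PropositionalEquality hiding ([_])
open import Relation.Nullary.Decidable using (Dec; yes; no; ¬?; map′; _×-dec_)
open import Relation.Nullary.Negation using (¬_)
open import Relation.Unary using (Pred)

-- The entry at position i (counted from 0) is the exponent of x_{i+1};
-- entries past the end of the list are 0.
Monomial : Set
Monomial = List ℕ

-- Counted from 0 as well: `exponent M i` belongs to x_{i+1}.
exponent : Monomial → ℕ → ℕ
exponent []       _       = 0
exponent (e ∷ _)  zero    = e
exponent (_ ∷ es) (suc i) = exponent es i

-- Trailing zeros are irrelevant.
infix 4 _≈ᴹ_ _≟ᴹ_

_≈ᴹ_ : Monomial → Monomial → Set
M ≈ᴹ N = ∀ i → exponent M i ≡ exponent N i

_≟ᴹ_ : ∀ M N → Dec (M ≈ᴹ N)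
[]       ≟ᴹ []       = yes λ _ → refl
[]       ≟ᴹ (f ∷ fs) = map′
  (λ { (p , q) zero → p ; (p , q) (suc i) → q i })
  (λ h → h 0 , λ i → h (suc i))
  ((0 ℕ.≟ f) ×-dec ([] ≟ᴹ fs))
(e ∷ es) ≟ᴹ []       = map′
  (λ { (p , q) zero → p ; (p , q) (suc i) → q i })
  (λ h → h 0 , λ i → h (suc i))
  ((e ℕ.≟ 0) ×-dec (es ≟ᴹ []))
(e ∷ es) ≟ᴹ (f ∷ fs) = map′
  (λ { (p , q) zero → p ; (p , q) (suc i) → q i })
  (λ h → h 0 , λ i → h (suc i))
  ((e ℕ.≟ f) ×-dec (es ≟ᴹ fs))

1ᴹ : Monomial
1ᴹ = []

infixl 7 _*ᴹ_

_*ᴹ_ : Monomial → Monomial → Monomial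
[]       *ᴹ N        = N
(e ∷ es) *ᴹ []       = e ∷ es
(e ∷ es) *ᴹ (f ∷ fs) = (e + f) ∷ (es *ᴹ fs)

∏ᴹ : List Monomial → Monomial
∏ᴹ = foldr _*ᴹ_ 1ᴹ

x[_]^_ : (l : ℕ) .{{_ : NonZero l}} → ℕ → Monomial
x[ suc i ]^ e = replicate i 0 ++ [ e ]

lcm≢0 : ∀ l m .{{_ : NonZero l}} .{{_ : NonZero m}} → NonZero (lcm l m)
lcm≢0 l m = m*n≢0⇒n≢0 (gcd l m) {{subst NonZero (sym (gcd*lcm l m)) (m*n≢0 l m)}}

-- x_l^i ⊛ x_m^j = x_{lcm(l,m)}^{i j gcd(l,m)}
powerProduct : (l i m j : ℕ) .{{_ : NonZero l}} .{{_ : NonZero m}} → Monomial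
powerProduct l i m j = (x[ lcm l m ]^ (i * j * gcd l m))
  where instance _ = lcm≢0 l m

-- The product over 1 ≤ l ≤ u, 1 ≤ m ≤ v, with l = suc a and m = suc b.
infixl 7 _⊛ᴹ_

_⊛ᴹ_ : Monomial → Monomial → Monomial
M ⊛ᴹ N = ∏ᴹ (cartesianProductWith
  (λ a b → powerProduct (suc a) (exponent M a) (suc b) (exponent N b))
  (upTo (length M)) (upTo (length N)))

-- A finite formal sum of terms; the same monomial may occur repeatedly.
Polynomial : Set
Polynomial = List (ℚ × Monomial)

coefficient : Polynomial → Monomial → ℚ
coefficient []            M = 0ℚ
coefficient ((a , N) ∷ P) M with N ≟ᴹ M
... | yes _ = a ℚ.+ coefficient P M
... | no  _ = coefficient P M

infix 4 _≈ᴾ_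

_≈ᴾ_ : Polynomial → Polynomial → Set
P ≈ᴾ Q = ∀ M → coefficient P M ≡ coefficient Q M

-- The sum runs over pairs of terms. As it is bilinear in the coefficients,
-- it does not matter whether terms with equal monomials have been collected.
infixl 7 _⊛_

_⊛_ : Polynomial → Polynomial → Polynomial
_⊛_ = cartesianProductWith λ t u → proj₁ t ℚ.* proj₁ u , proj₂ t ⊛ᴹ proj₂ u

module _ {N : ℕ} (π : Permutation′ N) where

  -- The cycle (x, π x, π² x, …) through x, stopping just before the first
  -- return to x, which happens after at most N steps.
  cycleThrough : Fin N → List (Fin N)
  cycleThrough x =
    x ∷ takeWhile (λ y → ¬? (y Fin.≟ x)) (iterate (π ⟨$⟩ʳ_) (π ⟨$⟩ʳ x) N)

  -- The disjoint cycle decomposition, fixed points included: every cycle is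
  -- listed once, starting from its least element.
  cycles : List (List (Fin N))
  cycles = map cycleThrough
    (filter (λ x → all? (x Fin.≤?_) (cycleThrough x)) (allFin N))

  -- λ_i(π), used for i ≥ 1.
  cycleCount : ℕ → ℕ
  cycleCount i = length (filter (λ c → length c ℕ.≟ i) cycles)

  ctype : Monomial
  ctype = applyUpTo (λ i → cycleCount (suc i)) N

permutationSetoid : ℕ → Setoid 0ℓ 0ℓ
permutationSetoid N = record
  { Carrier       = Permutation′ N
  ; _≈_           = Perm._≈_
  ; isEquivalence = record
    { refl  = λ _ → refl
    ; sym   = λ h i → sym (h i)
    ; trans = λ h k i → trans (h i) (k i)
    }
  }

record PermutationGroup (N : ℕ) : Set where
  open SetoidMembership (permutationSetoid N) using () renaming (_∈_ to _∈ₚ_)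
  open SetoidUnique (permutationSetoid N) using () renaming (Unique to Uniqueₚ)
  field
    elements  : List (Permutation′ N)
    unique    : Uniqueₚ elements
    id-mem    : Perm.id ∈ₚ elements
    ∘-closed  : ∀ {π ρ} → π ∈ₚ elements → ρ ∈ₚ elements → (π ∘ₚ ρ) ∈ₚ elements
    ⁻¹-closed : ∀ {π} → π ∈ₚ elements → flip π ∈ₚ elements

  order : ℕ
  order = length elements

  order≢0 : NonZero order
  order≢0 = nonEmpty id-mem
    where
    nonEmpty : ∀ {Q : Pred (Permutation′ N) 0ℓ} {xs} → Any Q xs → NonZero (length xs)
    nonEmpty (here  _) = _
    nonEmpty (there _) = _

cycleIndex : ∀ {N} → PermutationGroup N → Polynomial
cycleIndex G = map (λ π → 1/∣G∣ , ctype π) elements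
  where
  open PermutationGroup G
  1/∣G∣ : ℚ
  1/∣G∣ = (+ 1 ℚ./ order) {{order≢0}}

-- 𝒰 n is Aut(ℤ_n) acting on the residues ℤ_n, represented by Fin n.
module _ (n : ℕ) .{{_ : NonZero n}} where

  private
    *-cong-% : ∀ {a b c d} → a % n ≡ b % n → c % n ≡ d % n → (a * c) % n ≡ (b * d) % n
    *-cong-% {a} {b} {c} {d} p q = begin
      (a * c) % n                 ≡⟨ %-distribˡ-* a c n ⟩
      ((a % n) * (c % n)) % n     ≡⟨ cong₂ (λ s t → (s * t) % n) p q ⟩
      ((b % n) * (d % n)) % n     ≡⟨ %-distribˡ-* b d n ⟨
      (b * d) % n                 ∎
      where open ≡-Reasoning

    toℕ-mod : ∀ m → toℕ (m mod n) ≡ m % n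
    toℕ-mod m = toℕ-fromℕ< (m%n<n m n)

    toℕ-mod-% : ∀ m → toℕ (m mod n) % n ≡ m % n
    toℕ-mod-% m = trans (cong (_% n) (toℕ-mod m)) (m%n%n≡m%n m n)

    toℕ-% : ∀ (x : Fin n) → toℕ x % n ≡ toℕ x
    toℕ-% x = m<n⇒m%n≡m (toℕ<n x)

  mulMod : ℕ → Fin n → Fin n
  mulMod a x = (a * toℕ x) mod n

  private
    mulMod-cong : ∀ {a b} → a % n ≡ b % n → ∀ x → mulMod a x ≡ mulMod b x
    mulMod-cong {a} {b} p x = toℕ-injective
      (trans (toℕ-mod (a * toℕ x)) (trans (*-cong-% p refl) (sym (toℕ-mod (b * toℕ x)))))

    mulMod-∘ : ∀ a b x → mulMod a (mulMod b x) ≡ mulMod (a * b) x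
    mulMod-∘ a b x = toℕ-injective (begin
      toℕ (mulMod a (mulMod b x))       ≡⟨ toℕ-mod (a * toℕ (mulMod b x)) ⟩
      (a * toℕ (mulMod b x)) % n        ≡⟨ *-cong-% {a} refl (toℕ-mod-% (b * toℕ x)) ⟩
      (a * (b * toℕ x)) % n             ≡⟨ cong (_% n) (*-assoc a b (toℕ x)) ⟨
      (a * b * toℕ x) % n               ≡⟨ toℕ-mod (a * b * toℕ x) ⟨
      toℕ (mulMod (a * b) x)            ∎)
      where open ≡-Reasoning

    mulMod-1 : ∀ {a} → a % n ≡ 1 % n → ∀ x → mulMod a x ≡ x
    mulMod-1 {a} p x = trans (mulMod-cong p x) (toℕ-injective (begin
      toℕ (mulMod 1 x)   ≡⟨ toℕ-mod (1 * toℕ x) ⟩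
      (1 * toℕ x) % n    ≡⟨ cong (_% n) (*-identityˡ (toℕ x)) ⟩
      toℕ x % n          ≡⟨ toℕ-% x ⟩
      toℕ x              ∎))
      where open ≡-Reasoning

    invertible : ∀ a → gcd a n ≡ 1 → ∃[ b ] (b * a) % n ≡ 1 % n
    invertible a c with coprime-Bézout (gcd≡1⇒coprime c)
    ... | Bézout.+- x y eq = x , trans (cong (_% n) (sym eq)) ([m+kn]%n≡m%n 1 y n)
    ... | Bézout.-+ x y eq = pred n * x , (begin
      (pred n * x * a) % n              ≡⟨ [m+n]%n≡m%n (pred n * x * a) n ⟨
      (pred n * x * a + n) % n          ≡⟨ cong (λ t → (pred n * x * a + t) % n) (ℕ.suc-pred n) ⟨
      (pred n * x * a + suc (pred n)) % n ≡⟨ cong (_% n) (+-suc _ (pred n)) ⟩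
      suc (pred n * x * a + pred n) % n ≡⟨ cong (λ t → suc t % n) lemma ⟩
      (1 + pred n * y * n) % n          ≡⟨ [m+kn]%n≡m%n 1 (pred n * y) n ⟩
      1 % n                             ∎)
      where
      open ≡-Reasoning
      lemma : pred n * x * a + pred n ≡ pred n * y * n
      lemma = begin
        pred n * x * a + pred n           ≡⟨ cong₂ _+_ (*-assoc (pred n) x a) (sym (*-identityʳ (pred n))) ⟩
        pred n * (x * a) + pred n * 1     ≡⟨ *-distribˡ-+ (pred n) (x * a) 1 ⟨
        pred n * (x * a + 1)              ≡⟨ cong (pred n *_) (trans (+-comm (x * a) 1) eq) ⟩
        pred n * (y * n)                  ≡⟨ *-assoc (pred n) y n ⟨
        pred n * y * n                    ∎

    invertible⇒coprime : ∀ a b → (b * a) % n ≡ 1 % n → gcd a n ≡ 1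
    invertible⇒coprime a b eq = coprime⇒gcd≡1 λ {d} (d∣a , d∣n) →
      ∣1⇒≡1 (∣n∣m%n⇒∣m d∣n (subst (d ∣_) eq (%-presˡ-∣ (∣n⇒∣m*n b d∣a) d∣n)))

  -- π_a(x) = a x mod n; the inverse permutation is multiplication by an
  -- inverse of a modulo n.
  mulPerm : (a : Fin n) → gcd (toℕ a) n ≡ 1 → Permutation′ n
  mulPerm a c with invertible (toℕ a) c
  ... | b , ba≡1 = permutation (mulMod (toℕ a)) (mulMod b)
    (λ x → trans (mulMod-∘ (toℕ a) b x) (mulMod-1 (trans (cong (_% n) (*-comm (toℕ a) b)) ba≡1) x))
    (λ x → trans (mulMod-∘ b (toℕ a) x) (mulMod-1 ba≡1 x))

  IsUnit : Pred (Fin n) 0ℓ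
  IsUnit a = gcd (toℕ a) n ≡ 1

  isUnit? : ∀ a → Dec (IsUnit a)
  isUnit? a = gcd (toℕ a) n ℕ.≟ 1

  unitPerms : List (Permutation′ n)
  unitPerms = All.reduce {P = IsUnit} (λ {a} → mulPerm a) (all-filter isUnit? (allFin n))

  mulPerm-to : ∀ a c x → mulPerm a c ⟨$⟩ʳ x ≡ mulMod (toℕ a) x
  mulPerm-to a c x with invertible (toℕ a) c
  ... | b , ba≡1 = refl

  private
    open SetoidMembership (permutationSetoid n) using () renaming (_∈_ to _∈ₚ_)
    open SetoidUnique (permutationSetoid n) using () renaming (Unique to Uniqueₚ)

    reduce-mem⁺ : ∀ {π : Permutation′ n} {xs} (pxs : All IsUnit xs) {a} → a ∈ xs →
                  (∀ c → π Perm.≈ mulPerm a c) → π ∈ₚ All.reduce {P = IsUnit} (λ {a} → mulPerm a) pxs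
    reduce-mem⁺ {π} (p ∷ _)   (here refl) h = here (h p)
    reduce-mem⁺ {π} (_ ∷ pxs) (there m)   h = there (reduce-mem⁺ {π} pxs m h)

    reduce-mem⁻ : ∀ {π : Permutation′ n} {xs} (pxs : All IsUnit xs) →
                  π ∈ₚ All.reduce {P = IsUnit} (λ {a} → mulPerm a) pxs →
                  Σ[ a ∈ Fin n ] a ∈ xs × Σ[ c ∈ IsUnit a ] π Perm.≈ mulPerm a c
    reduce-mem⁻ {π} (p ∷ _)   (here h)  = _ , here refl , p , h
    reduce-mem⁻ {π} (_ ∷ pxs) (there m) with reduce-mem⁻ {π} pxs m
    ... | a , a∈ , c , h = a , there a∈ , c , h

    mem⁺ : ∀ {π : Permutation′ n} a b → (b * a) % n ≡ 1 % n → (∀ x → π ⟨$⟩ʳ x ≡ mulMod a x) → π ∈ₚ unitPerms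
    mem⁺ {π} a b eq h = reduce-mem⁺ {π} (all-filter isUnit? (allFin n))
      (∈-filter⁺ isUnit? (∈-allFin (a mod n))
        (invertible⇒coprime (toℕ (a mod n)) b (trans (*-cong-% {b} refl (toℕ-mod-% a)) eq)))
      λ c x → trans (h x) (trans (mulMod-cong (sym (toℕ-mod-% a)) x)
        (sym (mulPerm-to (a mod n) c x)))

    mem⁻ : ∀ {π : Permutation′ n} → π ∈ₚ unitPerms →
           ∃[ a ] ∃[ b ] (b * a) % n ≡ 1 % n × (∀ x → π ⟨$⟩ʳ x ≡ mulMod a x)
    mem⁻ {π} m =
      let a , _ , c , h = reduce-mem⁻ {π} (all-filter isUnit? (allFin n)) m
          b , eq        = invertible (toℕ a) c
      in toℕ a , b , eq , λ x → trans (h x) (mulPerm-to a c x)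

    mulPerm-injective : ∀ a c b d → mulPerm a c Perm.≈ mulPerm b d → a ≡ b
    mulPerm-injective a c b d h = toℕ-injective (begin
      toℕ a                             ≡⟨ at-1 a c ⟨
      toℕ (mulPerm a c ⟨$⟩ʳ (1 mod n))  ≡⟨ cong toℕ (h (1 mod n)) ⟩
      toℕ (mulPerm b d ⟨$⟩ʳ (1 mod n))  ≡⟨ at-1 b d ⟩
      toℕ b                             ∎)
      where
      open ≡-Reasoning
      at-1 : ∀ a c → toℕ (mulPerm a c ⟨$⟩ʳ (1 mod n)) ≡ toℕ a
      at-1 a c = begin
        toℕ (mulPerm a c ⟨$⟩ʳ (1 mod n))  ≡⟨ cong toℕ (mulPerm-to a c (1 mod n)) ⟩
        toℕ (mulMod (toℕ a) (1 mod n))    ≡⟨ toℕ-mod (toℕ a * toℕ (1 mod n)) ⟩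
        (toℕ a * toℕ (1 mod n)) % n       ≡⟨ *-cong-% {toℕ a} refl (toℕ-mod-% 1) ⟩
        (toℕ a * 1) % n                   ≡⟨ cong (_% n) (*-identityʳ (toℕ a)) ⟩
        toℕ a % n                         ≡⟨ toℕ-% a ⟩
        toℕ a                             ∎

    reduce-unique : ∀ {xs} (pxs : All IsUnit xs) → Unique xs →
                    Uniqueₚ (All.reduce {P = IsUnit} (λ {a} → mulPerm a) pxs)
    reduce-unique []        []       = []
    reduce-unique (p ∷ pxs) (q ∷ qs) = fresh _ p pxs q ∷ reduce-unique pxs qs
      where
      fresh : ∀ a c {xs} (pxs : All IsUnit xs) → All (a ≢_) xs →
              All (λ ρ → ¬ (mulPerm a c Perm.≈ ρ)) (All.reduce {P = IsUnit} (λ {a} → mulPerm a) pxs)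
      fresh a c []        []         = []
      fresh a c (p ∷ pxs) (a≢ ∷ a≢s) = (λ h → a≢ (mulPerm-injective a c _ p h)) ∷ fresh a c pxs a≢s

    interchange : ∀ b b′ a a′ → (b * b′) * (a * a′) ≡ (b * a) * (b′ * a′)
    interchange = ℕ.[m*n]*[o*p]≡[m*o]*[n*p]

  𝒰 : PermutationGroup n
  𝒰 = record
    { elements  = unitPerms
    ; unique    = reduce-unique (all-filter isUnit? (allFin n))
                    (Unique.filter⁺ isUnit? (Unique.allFin⁺ n))
    ; id-mem    = mem⁺ {Perm.id} 1 1 refl λ x → sym (mulMod-1 refl x)
    ; ∘-closed  = λ {π} {ρ} → closed {π} {ρ}
    ; ⁻¹-closed = λ {π} → inverse {π}
    }
    where
    closed : ∀ {π ρ : Permutation′ n} → π ∈ₚ unitPerms → ρ ∈ₚ unitPerms → (π ∘ₚ ρ) ∈ₚ unitPerms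
    closed {π} {ρ} p q =
      let a  , b  , ba≡1   , h  = mem⁻ {π} p
          a′ , b′ , b′a′≡1 , h′ = mem⁻ {ρ} q
      in mem⁺ {π ∘ₚ ρ} (a′ * a) (b′ * b)
        (trans (cong (_% n) (interchange b′ b a′ a))
          (*-cong-% {b′ * a′} {1} {b * a} {1} b′a′≡1 ba≡1))
        λ x → trans (h′ (π ⟨$⟩ʳ x)) (trans (cong (mulMod a′) (h x)) (mulMod-∘ a′ a x))
    inverse : ∀ {π : Permutation′ n} → π ∈ₚ unitPerms → flip π ∈ₚ unitPerms
    inverse {π} p =
      let a , b , ba≡1 , h = mem⁻ {π} p
      in mem⁺ {flip π} b a (trans (cong (_% n) (*-comm a b)) ba≡1) λ x → begin
        π ⟨$⟩ˡ x                           ≡⟨ mulMod-1 ba≡1 (π ⟨$⟩ˡ x) ⟨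
        mulMod (b * a) (π ⟨$⟩ˡ x)          ≡⟨ mulMod-∘ b a (π ⟨$⟩ˡ x) ⟨
        mulMod b (mulMod a (π ⟨$⟩ˡ x))     ≡⟨ cong (mulMod b) (h (π ⟨$⟩ˡ x)) ⟨
        mulMod b (π ⟨$⟩ʳ (π ⟨$⟩ˡ x))       ≡⟨ cong (mulMod b) (Perm.inverseʳ π) ⟩
        mulMod b x                         ∎
      where open ≡-Reasoning

prime^≢0 : ∀ {p} → Prime p → ∀ α → NonZero (p ^ α)
prime^≢0 {p} pr α = m^n≢0 p α {{prime⇒nonZero pr}}

{-# OPTIONS --safe #-}

-- By the Chinese remainder theorem, for coprime m and k the action of 𝒰 (m k)
-- on ℤ_{mk} is the product of the actions of 𝒰 m on ℤ_m and 𝒰 k on ℤ_k, so it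
-- suffices to compute the cycle type of a product permutation σ × τ. The
-- period of (u , v) is the lcm of the periods of u and v, and a permutation
-- with λ_i cycles of length i has exactly i λ_i points of period i. Counting
-- the points of period L in σ × τ gives
--   L λ_L(σ × τ) = Σ_{lcm(l,m) = L} l λ_l(σ) · m λ_m(τ)
--                = L Σ_{lcm(l,m) = L} gcd(l,m) λ_l(σ) λ_m(τ),
-- and cancelling L leaves the exponent of x_L in ctype σ ⊛ ctype τ.
module Submission where

open import Defs
open import Data.Nat.Base using (ℕ; suc; _^_; _≤_; NonZero)
open import Data.Nat.ListAction using (product)
open import Data.Nat.Primality using (Prime)
open import Data.Fin.Base using (Fin)
import Data.List.Base as List
import Data.Vec.Base as Vec
open import Function.Definitions using (Injective)
open import Relation.Binary.PropositionalEquality using (_≡_)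

open import Data.Bool.Base using (if_then_else_; true; false)
open import Data.Fin.Base using (toℕ; zero; suc)
import Data.Fin.Base as Fin
import Data.Fin.Properties as Fin
import Data.Fin.Induction as Fin
open import Data.Fin.Permutation using (Permutation′; _⟨$⟩ʳ_; _⟨$⟩ˡ_; inverseˡ; inverseʳ)
import Data.Integer.Base as ℤ
open import Data.List.Base
  using (List; []; _∷_; _++_; map; length; filter; upTo; applyUpTo; allFin; takeWhile;
         cartesianProduct; cartesianProductWith)
import Data.List.Properties as List
open import Data.List.Membership.Propositional using (_∈_; find)
open import Data.List.Membership.Propositional.Properties
open import Data.List.Membership.Propositional.Properties.WithK using (unique∧set⇒bag)
open import Data.List.Relation.Binary.BagAndSetEquality using (∼bag⇒↭)
open import Data.List.Relation.Binary.Permutation.Propositional using (_↭_)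
import Data.List.Relation.Binary.Permutation.Propositional as ↭
import Data.List.Relation.Binary.Permutation.Propositional.Properties as ↭
import Data.List.Relation.Binary.Permutation.Setoid as SetoidPermutation
import Data.List.Relation.Binary.Permutation.Setoid.Properties as SetoidPermutationProperties
open import Data.List.Relation.Binary.Pointwise.Base using (Pointwise; []; _∷_)
open import Data.List.Relation.Unary.All as All using (All; []; _∷_; all?)
import Data.List.Relation.Unary.All.Properties as All
open import Data.List.Relation.Unary.AllPairs using ([]; _∷_)
open import Data.List.Relation.Unary.Any using (here; there)
open import Data.List.Relation.Unary.Unique.Propositional using (Unique)
import Data.List.Relation.Unary.Unique.Propositional.Properties as Unique
open import Data.Nat.Base
open import Data.Nat.Coprimality as Coprime
  using (Coprime; gcd≡1⇒coprime; coprime⇒gcd≡1; coprime-divisor)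
open import Data.Nat.Divisibility
open import Data.Nat.DivMod
open import Data.Nat.GCD using (gcd)
open import Data.Nat.GeneralisedArithmetic using (iterate)
open import Data.Nat.LCM using (lcm; gcd*lcm; m∣lcm[m,n]; n∣lcm[m,n]; lcm-least)
open import Data.Nat.ListAction using (sum)
open import Data.Nat.ListAction.Properties using (sum-++; sum-↭)
open import Data.Nat.Primality using (prime⇒irreducible)
import Data.Nat.Properties as ℕ
open import Data.Nat.Tactic.RingSolver using (solve-∀)
open import Algebra.Properties.CommutativeSemigroup ℕ.+-commutativeSemigroup
  using () renaming (interchange to +-interchange)
open import Data.Product.Base using (_×_; _,_; ∃-syntax; proj₁; proj₂; <_,_>)
open import Data.Rational.Base as ℚ using (ℚ)
import Data.Rational.Properties as ℚ
import Data.Rational.Unnormalised.Base as ℚᵘ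
import Data.Rational.Unnormalised.Properties as ℚᵘ
open import Data.Sum.Base using (inj₁; inj₂)
open import Function.Base using (_∘_; id)
open import Function.Bundles using (mk⇔)
open import Induction.WellFounded using (Acc; acc)
open import Level using (0ℓ)
open import Relation.Binary.Bundles using (Setoid)
open import Relation.Binary.Definitions using (tri<; tri≈; tri>)
open import Relation.Binary.PropositionalEquality
  using (_≢_; refl; sym; trans; cong; cong₂; subst; module ≡-Reasoning)
open import Relation.Nullary.Decidable using (Dec; yes; no; does; ¬?; decidable-stable; dec-true; dec-false)
open import Relation.Nullary.Negation using (¬_; contradiction)
open import Relation.Unary using (Pred; Decidable)

-- Polynomials with equal coefficients may list different terms, while `⊛` runs over the listed
-- pairs of terms. The two-factor identity is therefore proved in a stronger form: the terms of both
-- sides correspond under a reordering (`↭ᴾ`). Reducing c modulo m and modulo k matches units with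
-- pairs of units, cycle types with `⊛ᴹ`-products and, by counting units, the coefficient of the
-- left side with the product of the two coefficients on the right. This relation is preserved when
-- the left argument of `⊛` is replaced, and an iterated product evaluated from left to right grows
-- exactly there, so the prime powers are absorbed one at a time; equality of coefficients is
-- deduced only at the very end. Points are counted instead of cycles because a cycle of length l
-- and one of length m give rise to gcd(l,m) cycles, whereas pairs of points and points correspond
-- one to one. The link between the two counts takes the least element of each cycle as its origin,
-- in agreement with the definition of `cycles`.

private
  variable
    A B C : Set

-- Lists without repetitions

unique-map⁺ : ∀ {f : A → B} {xs} → (∀ {x y} → x ∈ xs → y ∈ xs → f x ≡ f y → x ≡ y) →
              Unique xs → Unique (map f xs)
unique-map⁺ inj []       = []
unique-map⁺ inj (x∉ ∷ u) =
  All.map⁺ (All.tabulate λ y∈ eq → All.lookup x∉ y∈ (inj (here refl) (there y∈) eq)) ∷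
  unique-map⁺ (λ x∈ y∈ → inj (there x∈) (there y∈)) u

-- In a list without repetitions membership has at most one proof, so equality as sets is already
-- equality as bags. Every bijection in the proof becomes a reordering of lists through this lemma.
unique⇒↭ : ∀ {xs ys : List A} → Unique xs → Unique ys →
           (∀ {x} → x ∈ xs → x ∈ ys) → (∀ {x} → x ∈ ys → x ∈ xs) → xs ↭ ys
unique⇒↭ uxs uys to from = ∼bag⇒↭ (unique∧set⇒bag uxs uys (mk⇔ to from))

length-cartesianProduct : ∀ (xs : List A) (ys : List B) →
                          length (cartesianProduct xs ys) ≡ length xs * length ys
length-cartesianProduct []       ys = refl
length-cartesianProduct (x ∷ xs) ys = trans (List.length-++ (map (x ,_) ys))
  (cong₂ _+_ (List.length-map (x ,_) ys) (length-cartesianProduct xs ys))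

map-cartesianProduct : ∀ (f : A × B → C) xs ys →
                       map f (cartesianProduct xs ys) ≡ cartesianProductWith (λ x y → f (x , y)) xs ys
map-cartesianProduct f []       ys = refl
map-cartesianProduct f (x ∷ xs) ys = trans (List.map-++ f (map (x ,_) ys) _)
  (cong₂ _++_ (sym (List.map-∘ ys)) (map-cartesianProduct f xs ys))

cartesianProductWith-map : ∀ {A′ B′ : Set} (h : A → B → C) (f : A′ → A) (g : B′ → B) xs ys →
                           cartesianProductWith h (map f xs) (map g ys) ≡
                           cartesianProductWith (λ x y → h (f x) (g y)) xs ys
cartesianProductWith-map h f g []       ys = refl
cartesianProductWith-map h f g (x ∷ xs) ys =
  cong₂ _++_ (sym (List.map-∘ ys)) (cartesianProductWith-map h f g xs ys)

-- Finite sums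

∑ : List A → (A → ℕ) → ℕ
∑ xs f = sum (map f xs)

∑-cong : ∀ {f g : A → ℕ} xs → (∀ {x} → x ∈ xs → f x ≡ g x) → ∑ xs f ≡ ∑ xs g
∑-cong []       eq = refl
∑-cong (x ∷ xs) eq = cong₂ _+_ (eq (here refl)) (∑-cong xs (eq ∘ there))

∑-zero : ∀ {f : A → ℕ} xs → (∀ {x} → x ∈ xs → f x ≡ 0) → ∑ xs f ≡ 0
∑-zero []       eq = refl
∑-zero (x ∷ xs) eq = cong₂ _+_ (eq (here refl)) (∑-zero xs (eq ∘ there))

∑-distrib-+ : ∀ (f g : A → ℕ) xs → ∑ xs (λ x → f x + g x) ≡ ∑ xs f + ∑ xs g
∑-distrib-+ f g []       = refl
∑-distrib-+ f g (x ∷ xs) = trans (cong ((f x + g x) +_) (∑-distrib-+ f g xs))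
  (+-interchange (f x) (g x) (∑ xs f) (∑ xs g))

*-distribˡ-∑ : ∀ c (f : A → ℕ) xs → c * ∑ xs f ≡ ∑ xs (λ x → c * f x)
*-distribˡ-∑ c f []       = ℕ.*-zeroʳ c
*-distribˡ-∑ c f (x ∷ xs) =
  trans (ℕ.*-distribˡ-+ c (f x) (∑ xs f)) (cong (c * f x +_) (*-distribˡ-∑ c f xs))

∑-map : ∀ (g : A → B) (f : B → ℕ) xs → ∑ (map g xs) f ≡ ∑ xs (f ∘ g)
∑-map g f xs = cong sum (sym (List.map-∘ xs))

∑-↭ : ∀ (f : A → ℕ) {xs ys} → xs ↭ ys → ∑ xs f ≡ ∑ ys f
∑-↭ f = sum-↭ ∘ ↭.map⁺ f

∑-cartesianProductWith : ∀ (h : A → B → C) (f : C → ℕ) xs ys →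
                         ∑ (cartesianProductWith h xs ys) f ≡ ∑ xs λ x → ∑ ys λ y → f (h x y)
∑-cartesianProductWith h f []       ys = refl
∑-cartesianProductWith h f (x ∷ xs) ys = begin
  ∑ (map (h x) ys ++ rest) f               ≡⟨ cong sum (List.map-++ f (map (h x) ys) rest) ⟩
  sum (map f (map (h x) ys) ++ map f rest) ≡⟨ sum-++ (map f (map (h x) ys)) (map f rest) ⟩
  ∑ (map (h x) ys) f + ∑ rest f            ≡⟨ cong₂ _+_ (∑-map (h x) f ys) (∑-cartesianProductWith h f xs ys) ⟩
  (∑ ys λ y → f (h x y)) + (∑ xs λ x → ∑ ys λ y → f (h x y)) ∎
  where
  open ≡-Reasoning
  rest = cartesianProductWith h xs ys

-- Allows exponent lists of different lengths to be summed over one common range.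
∑-upTo-extend : ∀ (f : ℕ → ℕ) {k u} → k ≤ u → (∀ i → k ≤ i → f i ≡ 0) → ∑ (upTo k) f ≡ ∑ (upTo u) f
∑-upTo-extend f {k} {u} k≤u zeros = begin
  ∑ (upTo k) f         ≡⟨ cong sum (List.map-upTo f k) ⟩
  sum (applyUpTo f k)  ≡⟨ extend f k≤u zeros ⟩
  sum (applyUpTo f u)  ≡⟨ cong sum (List.map-upTo f u) ⟨
  ∑ (upTo u) f         ∎
  where
  open ≡-Reasoning
  extend : ∀ f {k u} → k ≤ u → (∀ i → k ≤ i → f i ≡ 0) → sum (applyUpTo f k) ≡ sum (applyUpTo f u)
  extend f {u = zero}  z≤n       zeros = refl
  extend f {u = suc u} z≤n       zeros = sym (cong₂ _+_ (zeros 0 z≤n) (sym (extend (f ∘ suc) {u = u} z≤n λ i _ → zeros (suc i) z≤n)))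
  extend f             (s≤s k≤u) zeros = cong (f 0 +_) (extend (f ∘ suc) k≤u λ i k≤i → zeros (suc i) (s≤s k≤i))

-- Kronecker delta and counting by fibres

δ : ℕ → ℕ → ℕ
δ i j = if does (j ℕ.≟ i) then 1 else 0

δ-≡ : ∀ {i j} → j ≡ i → δ i j ≡ 1
δ-≡ {i} {j} eq rewrite dec-true (j ℕ.≟ i) eq = refl

δ-≢ : ∀ {i j} → j ≢ i → δ i j ≡ 0
δ-≢ {i} {j} neq rewrite dec-false (j ℕ.≟ i) neq = refl

-- Both sides vanish unless the indices agree. Under the factor `δ L (lcm l m)` this permits trading
-- the lcm for `L`.
δ-subst : ∀ (f : ℕ → ℕ) i j → f i * δ i j ≡ f j * δ i j
δ-subst f i j with j ℕ.≟ i
... | yes refl = refl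
... | no  j≢i  rewrite δ-≢ j≢i = trans (ℕ.*-zeroʳ (f i)) (sym (ℕ.*-zeroʳ (f j)))

∑-δ : ∀ (g : ℕ → ℕ) {j is} → Unique is → j ∈ is → ∑ is (λ i → δ i j * g i) ≡ g j
∑-δ g {j} {i ∷ is} (i∉ ∷ _) (here refl) = begin
  δ i i * g i + ∑ is (λ k → δ k i * g k)  ≡⟨ cong₂ _+_ (cong (_* g i) (δ-≡ {i} refl)) (∑-zero is λ {k} k∈ → cong (_* g k) (δ-≢ (All.lookup i∉ k∈))) ⟩
  1 * g i + 0                             ≡⟨ ℕ.+-identityʳ _ ⟩
  1 * g i                                 ≡⟨ ℕ.*-identityˡ _ ⟩
  g i                                     ∎
  where open ≡-Reasoning
∑-δ g {j} {i ∷ is} (i∉ ∷ u) (there j∈) =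
  cong₂ _+_ (cong (_* g i) (δ-≢ (All.lookup i∉ j∈ ∘ sym))) (∑-δ g u j∈)

-- The sum over `xs` is regrouped by the value of `h`, the inner sum being the size of a fibre; the
-- range condition ensures that no element is lost. With `h` a period, it passes between sums over
-- points and sums over periods.
∑-fibres : ∀ (g : ℕ → ℕ) (h : A → ℕ) {is} → Unique is → ∀ xs → (∀ {x} → x ∈ xs → h x ∈ is) →
           ∑ is (λ i → ∑ xs (λ x → δ i (h x)) * g i) ≡ ∑ xs (g ∘ h)
∑-fibres g h {is} u []       range = ∑-zero is λ _ → refl
∑-fibres g h {is} u (x ∷ xs) range = begin
  ∑ is (λ i → (δ i (h x) + N i) * g i)                      ≡⟨ ∑-cong is (λ {i} _ → ℕ.*-distribʳ-+ (g i) (δ i (h x)) (N i)) ⟩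
  ∑ is (λ i → δ i (h x) * g i + N i * g i)                  ≡⟨ ∑-distrib-+ _ _ is ⟩
  ∑ is (λ i → δ i (h x) * g i) + ∑ is (λ i → N i * g i)     ≡⟨ cong₂ _+_ (∑-δ g u (range (here refl))) (∑-fibres g h u xs (range ∘ there)) ⟩
  g (h x) + ∑ xs (g ∘ h)                                    ∎
  where
  open ≡-Reasoning
  N : ℕ → ℕ
  N i = ∑ xs (λ x → δ i (h x))

length-filter-≟ : ∀ (h : A → ℕ) i xs → length (filter (λ x → h x ℕ.≟ i) xs) ≡ ∑ xs (λ x → δ i (h x))
length-filter-≟ h i []       = refl
-- The decision `h x ℕ.≟ i` computes through `h x ≡ᵇ i`, so one Boolean drives both the filter and
-- `δ`.
length-filter-≟ h i (x ∷ xs) with h x ≡ᵇ i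
... | true  = cong suc (length-filter-≟ h i xs)
... | false = length-filter-≟ h i xs

-- Exponents of monomials

exponent-≥ : ∀ M {i} → length M ≤ i → exponent M i ≡ 0
exponent-≥ []      _         = refl
exponent-≥ (_ ∷ M) (s≤s l≤i) = exponent-≥ M l≤i

exponent-applyUpTo : ∀ f n {i} → i < n → exponent (applyUpTo f n) i ≡ f i
exponent-applyUpTo f (suc n) {zero}  _         = refl
exponent-applyUpTo f (suc n) {suc i} (s≤s i<n) = exponent-applyUpTo (f ∘ suc) n i<n

exponent-*ᴹ : ∀ M N i → exponent (M *ᴹ N) i ≡ exponent M i + exponent N i
exponent-*ᴹ []      N       i       = refl
exponent-*ᴹ (e ∷ M) []      i       = sym (ℕ.+-identityʳ _)
exponent-*ᴹ (e ∷ M) (f ∷ N) zero    = refl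
exponent-*ᴹ (e ∷ M) (f ∷ N) (suc i) = exponent-*ᴹ M N i

exponent-∏ᴹ : ∀ Ms i → exponent (∏ᴹ Ms) i ≡ ∑ Ms (λ M → exponent M i)
exponent-∏ᴹ []       i = refl
exponent-∏ᴹ (M ∷ Ms) i = trans (exponent-*ᴹ M (∏ᴹ Ms) i) (cong (exponent M i +_) (exponent-∏ᴹ Ms i))

exponent-x^ : ∀ l .{{_ : NonZero l}} e i → exponent (x[ l ]^ e) i ≡ δ (suc i) l * e
exponent-x^ 1             e zero    = sym (ℕ.+-identityʳ e)
exponent-x^ 1             e (suc i) = refl
exponent-x^ (suc (suc l)) e zero    = refl
exponent-x^ (suc (suc l)) e (suc i) = exponent-x^ (suc l) e i

-- Exponents beyond the end of a list are zero and kill their terms, so any bounds `u` and `v` that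
-- cover both lists give the same sum. The shift by `suc` reflects that position `i` holds the
-- exponent of x_{i+1}.
exponent-⊛ᴹ : ∀ M N {u v} → length M ≤ u → length N ≤ v → ∀ i →
              exponent (M ⊛ᴹ N) i ≡ ∑ (upTo u) λ a → ∑ (upTo v) λ b →
                δ (suc i) (lcm (suc a) (suc b)) * (exponent M a * exponent N b * gcd (suc a) (suc b))
exponent-⊛ᴹ M N {u} {v} M≤u N≤v i = begin
  exponent (M ⊛ᴹ N) i
    ≡⟨ exponent-∏ᴹ (cartesianProductWith _ (upTo (length M)) (upTo (length N))) i ⟩
  ∑ (cartesianProductWith _ (upTo (length M)) (upTo (length N))) (λ P → exponent P i)
    ≡⟨ ∑-cartesianProductWith _ _ (upTo (length M)) (upTo (length N)) ⟩
  (∑ (upTo (length M)) λ a → ∑ (upTo (length N)) λ b →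
    exponent (powerProduct (suc a) (exponent M a) (suc b) (exponent N b)) i)
    ≡⟨ ∑-cong (upTo (length M)) (λ {a} _ → ∑-cong (upTo (length N)) λ {b} _ →
         exponent-x^ (lcm (suc a) (suc b)) {{lcm≢0 (suc a) (suc b)}} _ i) ⟩
  (∑ (upTo (length M)) λ a → ∑ (upTo (length N)) λ b → term a b)
    ≡⟨ ∑-cong (upTo (length M)) (λ {a} _ → ∑-upTo-extend (term a) N≤v λ b N≤b → vanishʳ a b (exponent-≥ N N≤b)) ⟩
  (∑ (upTo (length M)) λ a → ∑ (upTo v) λ b → term a b)
    ≡⟨ ∑-upTo-extend _ M≤u (λ a M≤a → ∑-zero (upTo v) λ {b} _ → vanishˡ a b (exponent-≥ M M≤a)) ⟩
  (∑ (upTo u) λ a → ∑ (upTo v) λ b → term a b) ∎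
  where
  open ≡-Reasoning
  term : ℕ → ℕ → ℕ
  term a b = δ (suc i) (lcm (suc a) (suc b)) * (exponent M a * exponent N b * gcd (suc a) (suc b))
  vanishˡ : ∀ a b → exponent M a ≡ 0 → term a b ≡ 0
  vanishˡ a b eq rewrite eq = ℕ.*-zeroʳ (δ (suc i) (lcm (suc a) (suc b)))
  vanishʳ : ∀ a b → exponent N b ≡ 0 → term a b ≡ 0
  vanishʳ a b eq rewrite eq | ℕ.*-zeroʳ (exponent M a) = ℕ.*-zeroʳ (δ (suc i) (lcm (suc a) (suc b)))

-- `⊛ᴹ` ranges over the lengths of its arguments, which `≈ᴹ` does not preserve; both sides are
-- therefore summed up to the larger length.
⊛ᴹ-congˡ : ∀ {M M′} N → M ≈ᴹ M′ → M ⊛ᴹ N ≈ᴹ M′ ⊛ᴹ N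
⊛ᴹ-congˡ {M} {M′} N M≈M′ i = begin
  exponent (M ⊛ᴹ N) i   ≡⟨ exponent-⊛ᴹ M N (ℕ.m≤m⊔n (length M) (length M′)) ℕ.≤-refl i ⟩
  _                     ≡⟨ ∑-cong (upTo (length M ⊔ length M′)) (λ {a} _ → ∑-cong (upTo (length N)) λ {b} _ →
                             cong (λ e → δ (suc i) (lcm (suc a) (suc b)) * (e * exponent N b * gcd (suc a) (suc b))) (M≈M′ a)) ⟩
  _                     ≡⟨ exponent-⊛ᴹ M′ N (ℕ.m≤n⊔m (length M) (length M′)) ℕ.≤-refl i ⟨
  exponent (M′ ⊛ᴹ N) i  ∎
  where open ≡-Reasoning

-- Periods of points under a permutation

iterate-+ : ∀ (f : A → A) m n x → iterate f x (m + n) ≡ iterate f (iterate f x m) n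
iterate-+ f zero    n x = refl
iterate-+ f (suc m) n x = iterate-+ f m n (f x)

iterate-multiple : ∀ (f : A → A) {x d} → iterate f x d ≡ x → ∀ q → iterate f x (q * d) ≡ x
iterate-multiple f         eq zero    = refl
iterate-multiple f {x} {d} eq (suc q) = begin
  iterate f x (d + q * d)            ≡⟨ iterate-+ f d (q * d) x ⟩
  iterate f (iterate f x d) (q * d)  ≡⟨ cong (λ y → iterate f y (q * d)) eq ⟩
  iterate f x (q * d)                ≡⟨ iterate-multiple f eq q ⟩
  x                                  ∎
  where open ≡-Reasoning

iterate-intertwine : ∀ {f : A → A} {g : B → B} {φ : A → B} → (∀ x → φ (f x) ≡ g (φ x)) →
                     ∀ x t → φ (iterate f x t) ≡ iterate g (φ x) t
iterate-intertwine         hom x zero    = refl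
iterate-intertwine {g = g} hom x (suc t) =
  trans (iterate-intertwine hom _ t) (cong (λ y → iterate g y t) (hom x))

∈-iterate⁺ : ∀ (f : A → A) x {n j} → j < n → iterate f x j ∈ List.iterate f x n
∈-iterate⁺ f x {suc n} {zero}  _         = here refl
∈-iterate⁺ f x {suc n} {suc j} (s≤s j<n) = there (∈-iterate⁺ f (f x) j<n)

∈-iterate⁻ : ∀ (f : A → A) x n {y} → y ∈ List.iterate f x n → ∃[ j ] y ≡ iterate f x j
∈-iterate⁻ f x (suc n) (here eq)  = 0 , eq
∈-iterate⁻ f x (suc n) (there y∈) with j , eq ← ∈-iterate⁻ f (f x) n y∈ = suc j , eq

module _ {P : Pred A 0ℓ} (P? : Decidable P) (f : A → A) where

  -- A failure of `P` at some index below `n` guarantees that `takeWhile` stops because of `P` and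
  -- not because the list runs out.
  takeWhile-iterate : ∀ y n {t} → t < n → ¬ P (iterate f y t) →
    ∃[ r ] takeWhile P? (List.iterate f y n) ≡ List.iterate f y r × r ≤ t ×
           ¬ P (iterate f y r) × (∀ j → j < r → P (iterate f y j))
  takeWhile-iterate y (suc n) {t} t<n ¬P with P? y
  ... | no ¬Py = 0 , refl , z≤n , ¬Py , λ _ ()
  takeWhile-iterate y (suc n) {zero}  t<n       ¬P | yes Py = contradiction Py ¬P
  takeWhile-iterate y (suc n) {suc t} (s≤s t<n) ¬P | yes Py
    with r , eq , r≤t , ¬Pr , below ← takeWhile-iterate (f y) n t<n ¬P =
    suc r , cong (y ∷_) eq , s≤s r≤t , ¬Pr , λ where
      zero    _         → Py
      (suc j) (s≤s j<r) → below j j<r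

module Periods {N : ℕ} (π : Permutation′ N) where

  private
    f : Fin N → Fin N
    f = π ⟨$⟩ʳ_

  -- Taken as the length of the listed cycle, so that it matches `cycleCount` directly; that it is
  -- the least positive return time is shown below.
  period : Fin N → ℕ
  period x = length (cycleThrough π x)

  f-injective : ∀ {x y} → f x ≡ f y → x ≡ y
  f-injective eq = trans (sym (inverseˡ π)) (trans (cong (π ⟨$⟩ˡ_) eq) (inverseˡ π))

  iterate-injective : ∀ t {x y} → iterate f x t ≡ iterate f y t → x ≡ y
  iterate-injective zero    eq = eq
  iterate-injective (suc t) eq = f-injective (iterate-injective t eq)

  iterate-cancel : ∀ {i j x} → i ≤ j → iterate f x i ≡ iterate f x j → iterate f x (j ∸ i) ≡ x
  iterate-cancel {i} {j} {x} i≤j eq = iterate-injective i (begin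
    iterate f (iterate f x (j ∸ i)) i  ≡⟨ iterate-+ f (j ∸ i) i x ⟨
    iterate f x (j ∸ i + i)            ≡⟨ cong (iterate f x) (ℕ.m∸n+n≡m i≤j) ⟩
    iterate f x j                      ≡⟨ eq ⟨
    iterate f x i                      ∎)
    where open ≡-Reasoning

  -- Among the N + 1 points x, f x, ..., f^N x two coincide, and cancelling the smaller index leaves
  -- a return after at least 1 and at most N steps.
  iterate-returns : ∀ x → ∃[ t ] t < N × iterate f x (suc t) ≡ x
  iterate-returns x
    with i , j , i<j , eq ← Fin.pigeonhole {N} {suc N} ℕ.≤-refl (λ i → iterate f x (toℕ i))
    with toℕ j ∸ toℕ i | ℕ.m<n⇒0<n∸m i<j | ℕ.m∸n≤m (toℕ j) (toℕ i) | iterate-cancel (ℕ.<⇒≤ i<j) eq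
  ... | suc t | _ | t<j | return = t , ℕ.≤-trans t<j (s≤s⁻¹ (Fin.toℕ<n j)) , return

  -- The return within N steps shows that the N iterates listed in `cycleThrough` are enough for
  -- `takeWhile` to stop at x itself. Everything later about periods is read off from this
  -- description.
  cycleThrough-iterate : ∀ x → ∃[ r ] cycleThrough π x ≡ List.iterate f x (suc r) × r < N ×
    iterate f x (suc r) ≡ x × (∀ j → j < r → iterate f x (suc j) ≢ x)
  cycleThrough-iterate x
    with t , t<N , return ← iterate-returns x
    with r , eq , r≤t , ¬¬return , below ←
      takeWhile-iterate (λ y → ¬? (y Fin.≟ x)) f (f x) N t<N (λ ¬return → ¬return return) =
    r , cong (x ∷_) eq , ℕ.≤-<-trans r≤t t<N , decidable-stable (_ Fin.≟ x) ¬¬return , below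

  cycleThrough-period : ∀ x → cycleThrough π x ≡ List.iterate f x (period x)
  cycleThrough-period x with r , eq , _ ← cycleThrough-iterate x =
    trans eq (cong (List.iterate f x) (sym (trans (cong length eq) (List.length-iterate f x (suc r)))))

  period≤N : ∀ x → period x ≤ N
  period≤N x with r , eq , r<N , _ ← cycleThrough-iterate x =
    subst (_≤ N) (sym (trans (cong length eq) (List.length-iterate f x (suc r)))) r<N

  iterate-period : ∀ x → iterate f x (period x) ≡ x
  iterate-period x with r , eq , _ , return , _ ← cycleThrough-iterate x =
    trans (cong (iterate f x) (trans (cong length eq) (List.length-iterate f x (suc r)))) return

  period-minimal : ∀ x {j} → 0 < j → iterate f x j ≡ x → period x ≤ j
  period-minimal x {suc j} _ return with r , eq , _ , _ , below ← cycleThrough-iterate x =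
    subst (_≤ suc j) (sym (trans (cong length eq) (List.length-iterate f x (suc r))))
      (s≤s (ℕ.≮⇒≥ λ j<r → below j j<r return))

  period∣⇒return : ∀ {x t} → period x ∣ t → iterate f x t ≡ x
  period∣⇒return {x} (divides-refl q) = iterate-multiple f (iterate-period x) q

  iterate-% : ∀ x t → iterate f x (t % period x) ≡ iterate f x t
  iterate-% x t = begin
    iterate f x (t % p)                          ≡⟨ cong (λ y → iterate f y (t % p)) (period∣⇒return (divides-refl (t / p))) ⟨
    iterate f (iterate f x (t / p * p)) (t % p)  ≡⟨ iterate-+ f (t / p * p) (t % p) x ⟨
    iterate f x (t / p * p + t % p)              ≡⟨ cong (iterate f x) (trans (ℕ.+-comm (t / p * p) (t % p)) (sym (m≡m%n+[m/n]*n t p))) ⟩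
    iterate f x t                                ∎
    where
    open ≡-Reasoning
    p = period x

  return⇒period∣ : ∀ {x t} → iterate f x t ≡ x → period x ∣ t
  return⇒period∣ {x} {t} return = m%n≡0⇒n∣m t (period x) (ℕ.n≤0⇒n≡0 (ℕ.≮⇒≥ λ 0<r →
    ℕ.<⇒≱ (m%n<n t (period x)) (period-minimal x 0<r (trans (iterate-% x t) return))))

  -- A number is determined by its multiples, so a period can be recognised from the set of times at
  -- which x returns. An lcm is characterised in the same way.
  period-unique : ∀ {x d} → (∀ {t} → d ∣ t → iterate f x t ≡ x) →
                  (∀ {t} → iterate f x t ≡ x → d ∣ t) → period x ≡ d
  period-unique {x} to from = ∣-antisym (return⇒period∣ (to ∣-refl)) (from (iterate-period x))

  period-iterate : ∀ x j → period (iterate f x j) ≡ period x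
  period-iterate x j = period-unique
    (λ {t} p∣t → trans (sym (iterate-+ f j t x)) (trans (cong (iterate f x) (ℕ.+-comm j t))
      (trans (iterate-+ f t j x) (cong (λ y → iterate f y j) (period∣⇒return p∣t)))))
    (λ {t} return → return⇒period∣ (iterate-injective j (trans (sym (iterate-+ f t j x))
      (trans (cong (iterate f x) (ℕ.+-comm t j)) (trans (iterate-+ f j t x) return)))))

  -- Since k + k (p - 1) = k p, going back k steps amounts to going forward k (p - 1) steps.
  iterate-inverse : ∀ x k → iterate f (iterate f x k) (k * pred (period x)) ≡ x
  iterate-inverse x k = begin
    iterate f (iterate f x k) (k * pred p)  ≡⟨ iterate-+ f k (k * pred p) x ⟨
    iterate f x (k + k * pred p)            ≡⟨ cong (iterate f x) (ℕ.*-suc k (pred p)) ⟨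
    iterate f x (k * p)                     ≡⟨ period∣⇒return (divides-refl k) ⟩
    x                                       ∎
    where
    open ≡-Reasoning
    p = period x

  -- Least elements of cycles

  IsLeast : Pred (Fin N) 0ℓ
  IsLeast x = All (x Fin.≤_) (cycleThrough π x)

  isLeast? : Decidable IsLeast
  isLeast? x = all? (x Fin.≤?_) (cycleThrough π x)

  IsLeast-iterate : ∀ {x} → IsLeast x → ∀ t → x Fin.≤ iterate f x t
  IsLeast-iterate {x} least t = All.lookup least
    (subst (iterate f x t ∈_) (sym (cycleThrough-period x))
      (subst (_∈ List.iterate f x (period x)) (iterate-% x t) (∈-iterate⁺ f x (m%n<n t (period x)))))

  -- If the orbits meet, each of the two points is a forward iterate of the other, hence each is at
  -- most the other.
  IsLeast-unique : ∀ {x y} i j → IsLeast x → IsLeast y → iterate f x i ≡ iterate f y j → x ≡ y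
  IsLeast-unique {x} {y} i j lx ly eq = Fin.≤-antisym (below i j lx eq) (below j i ly (sym eq))
    where
    below : ∀ {x y} i j → IsLeast x → iterate f x i ≡ iterate f y j → x Fin.≤ y
    below {x} {y} i j lx eq = subst (x Fin.≤_)
      (trans (iterate-+ f i (j * pred (period y)) x)
        (trans (cong (λ z → iterate f z (j * pred (period y))) eq) (iterate-inverse y j)))
      (IsLeast-iterate lx (i + j * pred (period y)))

  -- Well-founded descent: a point that is not least on its cycle has a smaller iterate, from which
  -- the search continues.
  least-exists : ∀ x → ∃[ k ] IsLeast (iterate f x k)
  least-exists x = go x (Fin.<-wellFounded x)
    where
    go : ∀ x → Acc Fin._<_ x → ∃[ k ] IsLeast (iterate f x k)
    go x (acc rec) with isLeast? x
    ... | yes least = 0 , least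
    ... | no ¬least
      with y , y∈ , x≰y ← find (All.¬All⇒Any¬ (x Fin.≤?_) _ ¬least)
      with j , refl ← ∈-iterate⁻ f x (period x) (subst (y ∈_) (cycleThrough-period x) y∈)
      with k , least ← go (iterate f x j) (rec (ℕ.≰⇒> x≰y)) =
      j + k , subst IsLeast (sym (iterate-+ f j k x)) least

  -- The points of period i are the f^j y with y the least element of a
  -- cycle of length i and j < i, each arising once.
  cycleCount-period : ∀ i → i * cycleCount π i ≡ ∑ (allFin N) (λ x → δ i (period x))
  cycleCount-period i = begin
    i * cycleCount π i                               ≡⟨ ℕ.*-comm i _ ⟩
    cycleCount π i * i                               ≡⟨ cong₂ _*_ count-reps (sym (List.length-upTo i)) ⟩
    length reps * length (upTo i)                    ≡⟨ length-cartesianProduct reps (upTo i) ⟨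
    length (cartesianProduct reps (upTo i))          ≡⟨ List.length-map point (cartesianProduct reps (upTo i)) ⟨
    length (map point (cartesianProduct reps (upTo i))) ≡⟨ ↭.↭-length points↭ ⟩
    length points                                    ≡⟨ length-filter-≟ period i (allFin N) ⟩
    ∑ (allFin N) (λ x → δ i (period x))              ∎
    where
    open ≡-Reasoning
    hasPeriod? : Decidable (λ x → period x ≡ i)
    hasPeriod? x = period x ℕ.≟ i

    leasts reps points : List (Fin N)
    leasts = filter isLeast? (allFin N)
    reps = filter hasPeriod? leasts
    points = filter hasPeriod? (allFin N)

    count-reps : cycleCount π i ≡ length reps
    count-reps = begin
      length (filter (λ c → length c ℕ.≟ i) (cycles π))  ≡⟨ length-filter-≟ length i (cycles π) ⟩
      ∑ (cycles π) (λ c → δ i (length c))                ≡⟨ ∑-map (cycleThrough π) (λ c → δ i (length c)) leasts ⟩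
      ∑ leasts (λ x → δ i (period x))                    ≡⟨ length-filter-≟ period i leasts ⟨
      length reps                                        ∎

    point : Fin N × ℕ → Fin N
    point (y , j) = iterate f y j

    ∈-reps⁻ : ∀ {y} → y ∈ reps → IsLeast y × period y ≡ i
    ∈-reps⁻ y∈ with y∈leasts , eq ← ∈-filter⁻ hasPeriod? {xs = leasts} y∈ =
      proj₂ (∈-filter⁻ isLeast? {xs = allFin N} y∈leasts) , eq

    no-return : ∀ {y j k} → y ∈ reps → k < i → j < k → iterate f y j ≢ iterate f y k
    no-return {y} {j} {k} y∈ k<i j<k eq = ℕ.<⇒≱ k<i (ℕ.≤-trans
      (subst (_≤ k ∸ j) (proj₂ (∈-reps⁻ y∈))
        (period-minimal y (ℕ.m<n⇒0<n∸m j<k) (iterate-cancel (ℕ.<⇒≤ j<k) eq)))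
      (ℕ.m∸n≤m k j))

    point-injective : ∀ {u v} → u ∈ cartesianProduct reps (upTo i) → v ∈ cartesianProduct reps (upTo i) →
                      point u ≡ point v → u ≡ v
    point-injective {y , j} {z , k} u∈ v∈ eq
      with y∈ , j∈ ← ∈-cartesianProduct⁻ reps (upTo i) u∈
      with z∈ , k∈ ← ∈-cartesianProduct⁻ reps (upTo i) v∈
      with refl ← IsLeast-unique j k (proj₁ (∈-reps⁻ y∈)) (proj₁ (∈-reps⁻ z∈)) eq
      with ℕ.<-cmp j k
    ... | tri< j<k _ _  = contradiction eq (no-return y∈ (∈-upTo⁻ k∈) j<k)
    ... | tri≈ _ refl _ = refl
    ... | tri> _ _ k<j  = contradiction (sym eq) (no-return y∈ (∈-upTo⁻ j∈) k<j)

    points↭ : map point (cartesianProduct reps (upTo i)) ↭ points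
    points↭ = unique⇒↭
      (unique-map⁺ point-injective (Unique.cartesianProduct⁺
        (Unique.filter⁺ hasPeriod? (Unique.filter⁺ isLeast? (Unique.allFin⁺ N))) (Unique.upTo⁺ i)))
      (Unique.filter⁺ hasPeriod? (Unique.allFin⁺ N))
      to from
      where
      to : ∀ {x} → x ∈ map point (cartesianProduct reps (upTo i)) → x ∈ points
      to x∈ with (y , j) , u∈ , refl ← ∈-map⁻ point x∈
        with y∈ , _ ← ∈-cartesianProduct⁻ reps (upTo i) u∈ =
        ∈-filter⁺ hasPeriod? (∈-allFin _) (trans (period-iterate y j) (proj₂ (∈-reps⁻ y∈)))

      from : ∀ {x} → x ∈ points → x ∈ map point (cartesianProduct reps (upTo i))
      from {x} x∈
        with _ , refl ← ∈-filter⁻ hasPeriod? {xs = allFin N} x∈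
        with k , least ← least-exists x = subst (_∈ map point (cartesianProduct reps (upTo i))) eq
          (∈-map⁺ point (∈-cartesianProduct⁺
            (∈-filter⁺ hasPeriod? (∈-filter⁺ isLeast? (∈-allFin y) least) (period-iterate x k))
            (∈-upTo⁺ (subst (λ p → (t % period y) < p) (period-iterate x k) (m%n<n t (period y))))))
        where
        y = iterate f x k
        -- `k` steps lead from `x` to the least element `y`, so `t` further steps lead back to `x`;
        -- reducing `t` modulo the period makes the index smaller than `i`.
        t = k * pred (period x)
        eq : iterate f y (t % period y) ≡ x
        eq = trans (iterate-% y t) (iterate-inverse x k)

  ctype-period : ∀ i → suc i * exponent (ctype π) i ≡ ∑ (allFin N) (λ x → δ (suc i) (period x))
  ctype-period i with ℕ.<-≤-connex i N
  ... | inj₁ i<N = trans (cong (suc i *_) (exponent-applyUpTo _ N i<N)) (cycleCount-period (suc i))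
  -- `ctype` records only lengths up to `N`; beyond them both sides vanish, as no period exceeds
  -- `N`.
  ... | inj₂ N≤i = begin
    suc i * exponent (ctype π) i             ≡⟨ cong (suc i *_) (exponent-≥ (ctype π) (ℕ.≤-trans (ℕ.≤-reflexive (List.length-applyUpTo _ N)) N≤i)) ⟩
    suc i * 0                                ≡⟨ ℕ.*-zeroʳ (suc i) ⟩
    0                                        ≡⟨ ∑-zero (allFin N) (λ {x} _ → δ-≢ (ℕ.<⇒≢ (s≤s (ℕ.≤-trans (period≤N x) N≤i)))) ⟨
    ∑ (allFin N) (λ x → δ (suc i) (period x)) ∎
    where open ≡-Reasoning

open Periods using (period)

-- Products of permutations

period∈range : ∀ {N} (π : Permutation′ N) x → period π x ∈ map suc (upTo N)
period∈range π x = ∈-map⁺ suc (∈-upTo⁺ (Periods.period≤N π x))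

-- The assumptions say that `< φ , ψ >` is a bijection carrying `π` to `σ` × `τ`. Describing the
-- product through its coordinate maps lets the residues modulo m k play this role directly.
module _ {N m k : ℕ} (π : Permutation′ N) (σ : Permutation′ m) (τ : Permutation′ k)
         (φ : Fin N → Fin m) (ψ : Fin N → Fin k)
         (injective : ∀ {x y} → φ x ≡ φ y → ψ x ≡ ψ y → x ≡ y)
         (surjective : ∀ u v → ∃[ x ] φ x ≡ u × ψ x ≡ v)
         (φ-hom : ∀ x → φ (π ⟨$⟩ʳ x) ≡ σ ⟨$⟩ʳ φ x)
         (ψ-hom : ∀ x → ψ (π ⟨$⟩ʳ x) ≡ τ ⟨$⟩ʳ ψ x) where

  -- By injectivity, `x` returns after t steps exactly when both coordinates do, that is, when t is
  -- a common multiple of their periods.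
  period-lcm : ∀ x → period π x ≡ lcm (period σ (φ x)) (period τ (ψ x))
  period-lcm x = Periods.period-unique π
    (λ {t} l∣t → injective
      (trans (iterate-intertwine φ-hom x t) (Periods.period∣⇒return σ (∣-trans (m∣lcm[m,n] p q) l∣t)))
      (trans (iterate-intertwine ψ-hom x t) (Periods.period∣⇒return τ (∣-trans (n∣lcm[m,n] p q) l∣t))))
    (λ {t} return → lcm-least
      (Periods.return⇒period∣ σ (trans (sym (iterate-intertwine φ-hom x t)) (cong φ return)))
      (Periods.return⇒period∣ τ (trans (sym (iterate-intertwine ψ-hom x t)) (cong ψ return))))
    where
    p = period σ (φ x)
    q = period τ (ψ x)

  pairs↭ : map < φ , ψ > (allFin N) ↭ cartesianProduct (allFin m) (allFin k)
  pairs↭ = unique⇒↭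
    (unique-map⁺ (λ _ _ eq → injective (cong proj₁ eq) (cong proj₂ eq)) (Unique.allFin⁺ N))
    (Unique.cartesianProduct⁺ (Unique.allFin⁺ m) (Unique.allFin⁺ k))
    (λ {(u , v)} _ → ∈-cartesianProduct⁺ (∈-allFin u) (∈-allFin v))
    (λ { {u , v} _ → let x , φx≡u , ψx≡v = surjective u v in
      subst (_∈ map < φ , ψ > (allFin N)) (cong₂ _,_ φx≡u ψx≡v) (∈-map⁺ < φ , ψ > (∈-allFin x)) })

  ctype-⊛ᴹ : ctype π ≈ᴹ ctype σ ⊛ᴹ ctype τ
  ctype-⊛ᴹ i = ℕ.*-cancelˡ-≡ _ _ (suc i) (begin
    L * exponent (ctype π) i
      ≡⟨ Periods.ctype-period π i ⟩
    ∑ (allFin N) (λ x → δ L (period π x))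
      ≡⟨ ∑-cong (allFin N) (λ {x} _ → cong (δ L) (period-lcm x)) ⟩
    ∑ (allFin N) (λ x → δ L (lcm (period σ (φ x)) (period τ (ψ x))))
      ≡⟨ ∑-map < φ , ψ > (λ (u , v) → δ L (lcm (period σ u) (period τ v))) (allFin N) ⟨
    ∑ (map < φ , ψ > (allFin N)) (λ (u , v) → δ L (lcm (period σ u) (period τ v)))
      ≡⟨ ∑-↭ (λ (u , v) → δ L (lcm (period σ u) (period τ v))) pairs↭ ⟩
    ∑ (cartesianProduct (allFin m) (allFin k)) (λ (u , v) → δ L (lcm (period σ u) (period τ v)))
      ≡⟨ ∑-cartesianProductWith _,_ (λ (u , v) → δ L (lcm (period σ u) (period τ v))) (allFin m) (allFin k) ⟩
    (∑ (allFin m) λ u → ∑ (allFin k) λ v → δ L (lcm (period σ u) (period τ v)))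
      -- The points of `σ` are grouped by period. Periods lie between 1 and `m`, so the index set is
      -- `upTo m` shifted by one, in line with the positions in `ctype σ`.
      ≡⟨ ∑-fibres (λ a → ∑ (allFin k) λ v → δ L (lcm a (period τ v))) (period σ) (unique-range m) (allFin m) (λ {u} _ → period∈range σ u) ⟨
    (∑ (map suc (upTo m)) λ a → #σ a * (∑ (allFin k) λ v → δ L (lcm a (period τ v))))
      ≡⟨ ∑-map suc (λ a → #σ a * (∑ (allFin k) λ v → δ L (lcm a (period τ v)))) (upTo m) ⟩
    (∑ (upTo m) λ a → #σ (suc a) * (∑ (allFin k) λ v → δ L (lcm (suc a) (period τ v))))
      ≡⟨ ∑-cong (upTo m) (λ {a} _ → row a) ⟩
    (∑ (upTo m) λ a → L * (∑ (upTo k) λ b → term a b))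
      ≡⟨ *-distribˡ-∑ L (λ a → ∑ (upTo k) (term a)) (upTo m) ⟨
    L * (∑ (upTo m) λ a → ∑ (upTo k) λ b → term a b)
      ≡⟨ cong (L *_) (exponent-⊛ᴹ (ctype σ) (ctype τ) (length-ctype σ) (length-ctype τ) i) ⟨
    L * exponent (ctype σ ⊛ᴹ ctype τ) i ∎)
    where
    open ≡-Reasoning
    L : ℕ
    L = suc i

    #σ #τ : ℕ → ℕ
    #σ a = ∑ (allFin m) (λ u → δ a (period σ u))
    #τ b = ∑ (allFin k) (λ v → δ b (period τ v))

    unique-range : ∀ n → Unique (map suc (upTo n))
    unique-range n = Unique.map⁺ ℕ.suc-injective (Unique.upTo⁺ n)

    length-ctype : ∀ {n} (ρ : Permutation′ n) → length (ctype ρ) ≤ n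
    length-ctype {n} ρ = ℕ.≤-reflexive (List.length-applyUpTo _ n)

    term : ℕ → ℕ → ℕ
    term a b = δ L (lcm (suc a) (suc b)) *
               (exponent (ctype σ) a * exponent (ctype τ) b * gcd (suc a) (suc b))

    rearrange₁ : ∀ a b e f d → a * e * (b * f * d) ≡ a * b * (e * f * d)
    rearrange₁ = solve-∀

    rearrange₂ : ∀ g l e f d → g * l * (e * f * d) ≡ e * f * g * (l * d)
    rearrange₂ = solve-∀

    rearrange₃ : ∀ x l d → x * (l * d) ≡ l * (d * x)
    rearrange₃ = solve-∀

    term-count : ∀ a b → #σ (suc a) * (#τ (suc b) * δ L (lcm (suc a) (suc b))) ≡ L * term a b
    term-count a b = begin
      #σ (suc a) * (#τ (suc b) * D)      ≡⟨ cong₂ (λ x y → x * (y * D)) (Periods.ctype-period σ a) (Periods.ctype-period τ b) ⟨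
      suc a * e * (suc b * f * D)        ≡⟨ rearrange₁ (suc a) (suc b) e f D ⟩
      -- The product of the two lengths splits into gcd times lcm: the gcd stays in the exponent,
      -- the lcm becomes the common factor `L`.
      suc a * suc b * (e * f * D)        ≡⟨ cong (_* (e * f * D)) (gcd*lcm (suc a) (suc b)) ⟨
      g * l * (e * f * D)                ≡⟨ rearrange₂ g l e f D ⟩
      -- `D` vanishes unless `l` equals `L`.
      e * f * g * (l * D)                ≡⟨ cong (e * f * g *_) (δ-subst id L l) ⟨
      e * f * g * (L * D)                ≡⟨ rearrange₃ (e * f * g) L D ⟩
      L * term a b                       ∎
      where
      e = exponent (ctype σ) a
      f = exponent (ctype τ) b
      g = gcd (suc a) (suc b)
      l = lcm (suc a) (suc b)
      D = δ L l

    row : ∀ a → #σ (suc a) * (∑ (allFin k) λ v → δ L (lcm (suc a) (period τ v))) ≡ L * ∑ (upTo k) (term a)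
    row a = begin
      #σ (suc a) * (∑ (allFin k) λ v → δ L (lcm (suc a) (period τ v)))
        ≡⟨ cong (#σ (suc a) *_) (∑-fibres (λ b → δ L (lcm (suc a) b)) (period τ) (unique-range k) (allFin k) (λ {v} _ → period∈range τ v)) ⟨
      #σ (suc a) * (∑ (map suc (upTo k)) λ b → #τ b * δ L (lcm (suc a) b))
        ≡⟨ cong (#σ (suc a) *_) (∑-map suc (λ b → #τ b * δ L (lcm (suc a) b)) (upTo k)) ⟩
      #σ (suc a) * (∑ (upTo k) λ b → #τ (suc b) * δ L (lcm (suc a) (suc b)))
        ≡⟨ *-distribˡ-∑ (#σ (suc a)) (λ b → #τ (suc b) * δ L (lcm (suc a) (suc b))) (upTo k) ⟩
      (∑ (upTo k) λ b → #σ (suc a) * (#τ (suc b) * δ L (lcm (suc a) (suc b))))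
        ≡⟨ ∑-cong (upTo k) (λ {b} _ → term-count a b) ⟩
      (∑ (upTo k) λ b → L * term a b)
        ≡⟨ *-distribˡ-∑ L (term a) (upTo k) ⟨
      L * ∑ (upTo k) (term a) ∎

-- Polynomials up to reordering of terms, a finer relation than ≈ᴾ that ⊛ respects term by term

infix 4 _≈ᵀ_

record _≈ᵀ_ (t u : ℚ × Monomial) : Set where
  constructor term≈
  field
    coefficient≡ : proj₁ t ≡ proj₁ u
    monomial≈    : proj₂ t ≈ᴹ proj₂ u

termSetoid : Setoid 0ℓ 0ℓ
termSetoid = record
  { Carrier       = ℚ × Monomial
  ; _≈_           = _≈ᵀ_
  ; isEquivalence = record
    { refl  = term≈ refl λ _ → refl
    ; sym   = λ (term≈ p q) → term≈ (sym p) λ i → sym (q i)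
    ; trans = λ (term≈ p q) (term≈ p′ q′) → term≈ (trans p p′) λ i → trans (q i) (q′ i)
    }
  }

open SetoidPermutation termSetoid using () renaming (_↭_ to _↭ᴾ_)
module ↭ᴾ where
  open SetoidPermutation termSetoid public
  open SetoidPermutationProperties termSetoid public

map-pointwise : ∀ {f g : A → ℚ × Monomial} xs → (∀ {x} → x ∈ xs → f x ≈ᵀ g x) →
                Pointwise _≈ᵀ_ (map f xs) (map g xs)
map-pointwise []       eq = []
map-pointwise (x ∷ xs) eq = eq (here refl) ∷ map-pointwise xs (eq ∘ there)

contribution : ℚ × Monomial → Monomial → ℚ
contribution (a , N) M = if does (N ≟ᴹ M) then a else ℚ.0ℚ

-- Turns the case split inside `coefficient` into an addition, so that exchanging terms reduces to
-- the laws of addition in ℚ.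
coefficient-∷ : ∀ t P M → coefficient (t ∷ P) M ≡ contribution t M ℚ.+ coefficient P M
coefficient-∷ (a , N) P M with N ≟ᴹ M
... | yes _ = refl
... | no  _ = sym (ℚ.+-identityˡ _)

contribution-cong : ∀ {t u} → t ≈ᵀ u → ∀ M → contribution t M ≡ contribution u M
contribution-cong {a , N} {_ , N′} (term≈ refl N≈N′) M with N ≟ᴹ M | N′ ≟ᴹ M
... | yes _   | yes _    = refl
... | no  _   | no  _    = refl
... | yes N≈M | no N′≉M  = contradiction (λ i → trans (sym (N≈N′ i)) (N≈M i)) N′≉M
... | no  N≉M | yes N′≈M = contradiction (λ i → trans (N≈N′ i) (N′≈M i)) N≉M

coefficient-∷-cong : ∀ {t u} P Q M → t ≈ᵀ u → coefficient P M ≡ coefficient Q M →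
                     coefficient (t ∷ P) M ≡ coefficient (u ∷ Q) M
coefficient-∷-cong {t} {u} P Q M t≈u eq = begin
  coefficient (t ∷ P) M                   ≡⟨ coefficient-∷ t P M ⟩
  contribution t M ℚ.+ coefficient P M    ≡⟨ cong₂ ℚ._+_ (contribution-cong t≈u M) eq ⟩
  contribution u M ℚ.+ coefficient Q M    ≡⟨ coefficient-∷ u Q M ⟨
  coefficient (u ∷ Q) M                   ∎
  where open ≡-Reasoning

coefficient-swap : ∀ t u P M → coefficient (t ∷ u ∷ P) M ≡ coefficient (u ∷ t ∷ P) M
coefficient-swap t u P M = begin
  coefficient (t ∷ u ∷ P) M      ≡⟨ expand t u ⟩
  T ℚ.+ (U ℚ.+ coefficient P M)  ≡⟨ ℚ.+-assoc T U _ ⟨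
  T ℚ.+ U ℚ.+ coefficient P M    ≡⟨ cong (ℚ._+ coefficient P M) (ℚ.+-comm T U) ⟩
  U ℚ.+ T ℚ.+ coefficient P M    ≡⟨ ℚ.+-assoc U T _ ⟩
  U ℚ.+ (T ℚ.+ coefficient P M)  ≡⟨ expand u t ⟨
  coefficient (u ∷ t ∷ P) M      ∎
  where
  open ≡-Reasoning
  T = contribution t M
  U = contribution u M
  expand : ∀ t u → coefficient (t ∷ u ∷ P) M ≡ contribution t M ℚ.+ (contribution u M ℚ.+ coefficient P M)
  expand t u = trans (coefficient-∷ t (u ∷ P) M) (cong (contribution t M ℚ.+_) (coefficient-∷ u P M))

↭ᴾ⇒≈ᴾ : ∀ {P Q} → P ↭ᴾ Q → P ≈ᴾ Q
↭ᴾ⇒≈ᴾ (↭ᴾ.refl pw) M = pointwise pw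
  where
  pointwise : ∀ {P Q} → Pointwise _≈ᵀ_ P Q → coefficient P M ≡ coefficient Q M
  pointwise []         = refl
  pointwise (eq ∷ eqs) = coefficient-∷-cong _ _ M eq (pointwise eqs)
↭ᴾ⇒≈ᴾ (↭ᴾ.prep eq P↭Q) M = coefficient-∷-cong _ _ M eq (↭ᴾ⇒≈ᴾ P↭Q M)
↭ᴾ⇒≈ᴾ (↭ᴾ.swap {x = t} {y = u} eq₁ eq₂ P↭Q) M = trans (coefficient-swap t u _ M)
  (coefficient-∷-cong _ _ M eq₂ (coefficient-∷-cong _ _ M eq₁ (↭ᴾ⇒≈ᴾ P↭Q M)))
↭ᴾ⇒≈ᴾ (↭ᴾ.trans P↭Q Q↭R) M = trans (↭ᴾ⇒≈ᴾ P↭Q M) (↭ᴾ⇒≈ᴾ Q↭R M)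

-- `P ⊛ R` is a concatenation of rows, one for each term of `P`; rearranging the terms of `P`
-- rearranges whole rows.
⊛-congˡ : ∀ {P Q} R → P ↭ᴾ Q → P ⊛ R ↭ᴾ Q ⊛ R
⊛-congˡ R = go
  where
  row : ℚ × Monomial → Polynomial
  row t = map (λ u → proj₁ t ℚ.* proj₁ u , proj₂ t ⊛ᴹ proj₂ u) R

  row-cong : ∀ {t u} → t ≈ᵀ u → row t ↭ᴾ row u
  row-cong {t} {u} (term≈ p q) = ↭ᴾ.refl (map-pointwise R λ {v} _ →
    term≈ (cong (ℚ._* proj₁ v) p) (⊛ᴹ-congˡ {proj₂ t} {proj₂ u} (proj₂ v) q))

  go : ∀ {P Q} → P ↭ᴾ Q → P ⊛ R ↭ᴾ Q ⊛ R
  go (↭ᴾ.refl [])         = ↭ᴾ.↭-refl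
  go (↭ᴾ.refl (eq ∷ eqs)) = ↭ᴾ.++⁺ (row-cong eq) (go (↭ᴾ.refl eqs))
  go (↭ᴾ.prep eq P↭Q)     = ↭ᴾ.++⁺ (row-cong eq) (go P↭Q)
  -- Exchanging two adjacent terms exchanges two adjacent blocks, which is what `shifts` does.
  go (↭ᴾ.swap {x = t} {y = u} eq₁ eq₂ P↭Q) = ↭ᴾ.trans (↭ᴾ.shifts (row t) (row u))
    (↭ᴾ.++⁺ (row-cong eq₂) (↭ᴾ.++⁺ (row-cong eq₁) (go P↭Q)))
  go (↭ᴾ.trans P↭Q Q↭R)   = ↭ᴾ.trans (go P↭Q) (go Q↭R)

-- Residues modulo coprime numbers

%-congʳ-+ : ∀ c {a b} n .{{_ : NonZero n}} → a % n ≡ b % n → (c + a) % n ≡ (c + b) % n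
%-congʳ-+ c {a} {b} n eq = begin
  (c + a) % n          ≡⟨ %-distribˡ-+ c a n ⟩
  (c % n + a % n) % n  ≡⟨ cong (λ r → (c % n + r) % n) eq ⟩
  (c % n + b % n) % n  ≡⟨ %-distribˡ-+ c b n ⟨
  (c + b) % n          ∎
  where open ≡-Reasoning

-- Subtraction is truncated, but so is the difference of the quotients, so the cases a ≤ b and a > b
-- need no separation.
%≡%⇒∣∸ : ∀ a b m .{{_ : NonZero m}} → a % m ≡ b % m → m ∣ a ∸ b
%≡%⇒∣∸ a b m eq = divides (a / m ∸ b / m) (begin
  a ∸ b                                          ≡⟨ cong₂ _∸_ (m≡m%n+[m/n]*n a m) (m≡m%n+[m/n]*n b m) ⟩
  (a % m + a / m * m) ∸ (b % m + b / m * m)      ≡⟨ cong (λ r → (a % m + a / m * m) ∸ (r + b / m * m)) eq ⟨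
  (a % m + a / m * m) ∸ (a % m + b / m * m)      ≡⟨ ℕ.[m+n]∸[m+o]≡n∸o (a % m) (a / m * m) (b / m * m) ⟩
  a / m * m ∸ b / m * m                          ≡⟨ ℕ.*-distribʳ-∸ m (a / m) (b / m) ⟨
  (a / m ∸ b / m) * m                            ∎)
  where open ≡-Reasoning

∣∧<⇒≡0 : ∀ {n d} .{{_ : NonZero n}} → n ∣ d → d < n → d ≡ 0
∣∧<⇒≡0 {n} {d} n∣d d<n = trans (sym (m<n⇒m%n≡m d<n)) (n∣m⇒m%n≡0 d n n∣d)

coprime-∣⇒*∣ : ∀ {m k d} → Coprime m k → m ∣ d → k ∣ d → m * k ∣ d
coprime-∣⇒*∣ {m} {k} {d} c (divides q d≡qm) k∣d = subst (m * k ∣_) (sym d≡mq)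
  (*-monoʳ-∣ m (coprime-divisor (Coprime.sym c) (subst (k ∣_) d≡mq k∣d)))
  where
  d≡mq : d ≡ m * q
  d≡mq = trans d≡qm (ℕ.*-comm q m)

-- A common divisor d of m k and o is itself coprime to m, hence divides k, and so is a common
-- divisor of k and o.
coprime-* : ∀ {m k o} → Coprime m o → Coprime k o → Coprime (m * k) o
coprime-* c c′ (d∣mk , d∣o) =
  c′ (coprime-divisor (λ (e∣d , e∣m) → c (e∣m , ∣-trans e∣d d∣o)) d∣mk , d∣o)

coprime-%⁺ : ∀ {a} m .{{_ : NonZero m}} → Coprime a m → Coprime (a % m) m
coprime-%⁺ m c (d∣a%m , d∣m) = c (∣n∣m%n⇒∣m d∣m d∣a%m , d∣m)

coprime-%⁻ : ∀ {a} m .{{_ : NonZero m}} → Coprime (a % m) m → Coprime a m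
coprime-%⁻ m c (d∣a , d∣m) = c (%-presˡ-∣ d∣a d∣m , d∣m)

toℕ-mod : ∀ a n .{{_ : NonZero n}} → toℕ (a mod n) ≡ a % n
toℕ-mod a n = Fin.toℕ-fromℕ< (m%n<n a n)

toℕ-% : ∀ {n} .{{_ : NonZero n}} (x : Fin n) → toℕ x % n ≡ toℕ x
toℕ-% x = m<n⇒m%n≡m (Fin.toℕ<n x)

residue : ∀ {n} m .{{_ : NonZero m}} → Fin n → Fin m
residue m x = toℕ x mod m

residue-mod : ∀ {n} m .{{_ : NonZero m}} .{{_ : NonZero n}} → m ∣ n → ∀ a → residue m (a mod n) ≡ a mod m
residue-mod {n} m m∣n a = Fin.toℕ-injective (begin
  toℕ (residue m (a mod n))  ≡⟨ toℕ-mod (toℕ (a mod n)) m ⟩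
  toℕ (a mod n) % m          ≡⟨ cong (_% m) (toℕ-mod a n) ⟩
  a % n % m                  ≡⟨ m∣n⇒o%n%m≡o%m m n a m∣n ⟩
  a % m                      ≡⟨ toℕ-mod a m ⟨
  toℕ (a mod m)              ∎)
  where open ≡-Reasoning

residue-mulMod : ∀ {n} m .{{_ : NonZero m}} .{{_ : NonZero n}} → m ∣ n → ∀ (c x : Fin n) →
                 residue m (mulMod n (toℕ c) x) ≡ mulMod m (toℕ (residue m c)) (residue m x)
residue-mulMod {n} m m∣n c x = trans (residue-mod m m∣n (toℕ c * toℕ x)) (Fin.toℕ-injective (begin
  toℕ ((toℕ c * toℕ x) mod m)                        ≡⟨ toℕ-mod (toℕ c * toℕ x) m ⟩
  (toℕ c * toℕ x) % m                                ≡⟨ %-distribˡ-* (toℕ c) (toℕ x) m ⟩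
  (toℕ c % m * (toℕ x % m)) % m                      ≡⟨ cong₂ (λ a b → (a * b) % m) (toℕ-mod (toℕ c) m) (toℕ-mod (toℕ x) m) ⟨
  (toℕ (residue m c) * toℕ (residue m x)) % m        ≡⟨ toℕ-mod (toℕ (residue m c) * toℕ (residue m x)) m ⟨
  toℕ (mulMod m (toℕ (residue m c)) (residue m x))   ∎))
  where open ≡-Reasoning

mod-≡⇒%-≡ : ∀ {a b} m .{{_ : NonZero m}} → a mod m ≡ b mod m → a % m ≡ b % m
mod-≡⇒%-≡ {a} {b} m eq = trans (sym (toℕ-mod a m)) (trans (cong toℕ eq) (toℕ-mod b m))

module ChineseRemainder (m k : ℕ) .{{_ : NonZero m}} .{{_ : NonZero k}} .{{_ : NonZero (m * k)}}
                        (coprime : Coprime m k) where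

  -- The truncated difference of x and y is divisible by m k and smaller than m k, hence zero;
  -- taking it in both orders gives equality.
  residues-injective : ∀ {x y : Fin (m * k)} → residue m x ≡ residue m y → residue k x ≡ residue k y → x ≡ y
  residues-injective {x} {y} eqᵐ eqᵏ = Fin.toℕ-injective (ℕ.≤-antisym
    (below x y (mod-≡⇒%-≡ m eqᵐ) (mod-≡⇒%-≡ k eqᵏ))
    (below y x (mod-≡⇒%-≡ m (sym eqᵐ)) (mod-≡⇒%-≡ k (sym eqᵏ))))
    where
    below : ∀ (x y : Fin (m * k)) → toℕ x % m ≡ toℕ y % m → toℕ x % k ≡ toℕ y % k → toℕ x ≤ toℕ y
    below x y eqᵐ eqᵏ = ℕ.m∸n≡0⇒m≤n (∣∧<⇒≡0
      (coprime-∣⇒*∣ coprime (%≡%⇒∣∸ (toℕ x) (toℕ y) m eqᵐ) (%≡%⇒∣∸ (toℕ x) (toℕ y) k eqᵏ))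
      (ℕ.≤-<-trans (ℕ.m∸n≤m (toℕ x) (toℕ y)) (Fin.toℕ<n x)))

  -- The solution u + m t, where t solves m t ≡ v - u (mod k).
  residues-surjective : ∀ u v → ∃[ x ] residue {m * k} m x ≡ u × residue {m * k} k x ≡ v
  residues-surjective u v = x mod (m * k) ,
    trans (residue-mod m (m∣m*n k) x) (Fin.toℕ-injective x≡u) ,
    trans (residue-mod k (n∣m*n m) x) (Fin.toℕ-injective x≡v)
    where
    open ≡-Reasoning
    m-unit : IsUnit k (m mod k)
    m-unit = coprime⇒gcd≡1 (subst (λ r → Coprime r k) (sym (toℕ-mod m k)) (coprime-%⁺ k coprime))

    ρ : Permutation′ k
    -- Multiplication by `m` permutes the residues modulo `k`; its inverse permutation divides by
    -- `m` and so solves the congruence for `t`.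
    ρ = mulPerm k (m mod k) m-unit

    w t x : ℕ
    -- `pred k` is -1 modulo `k`, so `w` represents v - u without subtraction.
    w = toℕ v + pred k * toℕ u
    t = toℕ (ρ ⟨$⟩ˡ (w mod k))
    x = toℕ u + m * t

    mt≡w : (m * t) % k ≡ w % k
    mt≡w = begin
      (m * t) % k                                        ≡⟨ %-distribˡ-* m t k ⟩
      (m % k * (t % k)) % k                              ≡⟨ cong₂ (λ a b → (a * b) % k) (toℕ-mod m k) (sym (toℕ-% _)) ⟨
      (toℕ (m mod k) * t) % k                            ≡⟨ toℕ-mod (toℕ (m mod k) * t) k ⟨
      toℕ (mulMod k (toℕ (m mod k)) (ρ ⟨$⟩ˡ (w mod k)))  ≡⟨ cong toℕ (mulPerm-to k (m mod k) m-unit (ρ ⟨$⟩ˡ (w mod k))) ⟨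
      toℕ (ρ ⟨$⟩ʳ (ρ ⟨$⟩ˡ (w mod k)))                    ≡⟨ cong toℕ (inverseʳ ρ) ⟩
      toℕ (w mod k)                                      ≡⟨ toℕ-mod w k ⟩
      w % k                                              ∎

    x≡u : toℕ (x mod m) ≡ toℕ u
    x≡u = begin
      toℕ (x mod m)  ≡⟨ toℕ-mod x m ⟩
      x % m          ≡⟨ %-remove-+ʳ (toℕ u) (m∣m*n t) ⟩
      toℕ u % m      ≡⟨ toℕ-% u ⟩
      toℕ u          ∎

    rearrange : ∀ a b p → a + (b + p * a) ≡ b + a * suc p
    rearrange = solve-∀

    x≡v : toℕ (x mod k) ≡ toℕ v
    x≡v = begin
      toℕ (x mod k)                       ≡⟨ toℕ-mod x k ⟩
      x % k                               ≡⟨ %-congʳ-+ (toℕ u) k mt≡w ⟩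
      (toℕ u + w) % k                     ≡⟨ cong (_% k) (rearrange (toℕ u) (toℕ v) (pred k)) ⟩
      (toℕ v + toℕ u * suc (pred k)) % k  ≡⟨ cong (λ r → (toℕ v + toℕ u * r) % k) (ℕ.suc-pred k) ⟩
      (toℕ v + toℕ u * k) % k             ≡⟨ [m+kn]%n≡m%n (toℕ v) (toℕ u) k ⟩
      toℕ v % k                           ≡⟨ toℕ-% v ⟩
      toℕ v                               ∎

-- Units and their residues modulo a divisor

units : ∀ n .{{_ : NonZero n}} → List (Fin n)
units n = filter (isUnit? n) (allFin n)

∈-units⁺ : ∀ {n} .{{_ : NonZero n}} {a : Fin n} → Coprime (toℕ a) n → a ∈ units n
∈-units⁺ {n} {a} c = ∈-filter⁺ (isUnit? n) (∈-allFin a) (coprime⇒gcd≡1 c)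

∈-units⁻ : ∀ {n} .{{_ : NonZero n}} {a : Fin n} → a ∈ units n → Coprime (toℕ a) n
∈-units⁻ {n} a∈ = gcd≡1⇒coprime (proj₂ (∈-filter⁻ (isUnit? n) {xs = allFin n} a∈))

unique-units : ∀ n .{{_ : NonZero n}} → Unique (units n)
unique-units n = Unique.filter⁺ (isUnit? n) (Unique.allFin⁺ n)

residue-units⁺ : ∀ {n} m .{{_ : NonZero m}} .{{_ : NonZero n}} → m ∣ n → ∀ {c : Fin n} → c ∈ units n → residue m c ∈ units m
residue-units⁺ m m∣n {c} c∈ = ∈-units⁺ (subst (λ r → Coprime r m) (sym (toℕ-mod (toℕ c) m))
  (coprime-%⁺ m λ (d∣c , d∣m) → ∈-units⁻ c∈ (d∣c , ∣-trans d∣m m∣n)))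

residue-units⁻ : ∀ {n} m .{{_ : NonZero m}} (c : Fin n) → residue m c ∈ units m → Coprime (toℕ c) m
residue-units⁻ m c c∈ = coprime-%⁻ m (subst (λ r → Coprime r m) (toℕ-mod (toℕ c) m) (∈-units⁻ c∈))

-- Cycle indices of unit groups

caseDec : ∀ {P : Set} → (P → A) → A → Dec P → A
caseDec f b (yes p) = f p
caseDec f b (no _)  = b

caseDec-yes : ∀ {P : Set} (f : P → A) {b} → (∀ p q → f p ≡ f q) → ∀ P? p → caseDec f b P? ≡ f p
caseDec-yes f const (yes q) p = const q p
caseDec-yes f const (no ¬p) p = contradiction p ¬p

-- The value at non-units is junk.
unitCtype : ∀ n .{{_ : NonZero n}} → Fin n → Monomial
unitCtype n a = caseDec (λ c → ctype (mulPerm n a c)) 1ᴹ (isUnit? n a)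

-- Equality proofs in ℕ are unique, so the coprimality proof supplied by `isUnit?` may be exchanged
-- for any other.
unitCtype-mulPerm : ∀ n .{{_ : NonZero n}} a (c : IsUnit n a) → unitCtype n a ≡ ctype (mulPerm n a c)
unitCtype-mulPerm n a = caseDec-yes (λ c → ctype (mulPerm n a c))
  (λ c c′ → cong (λ c → ctype (mulPerm n a c)) (ℕ.≡-irrelevant c c′)) (isUnit? n a)

map-reduce : ∀ {P : Pred A 0ℓ} (g : B → C) {f : ∀ {x} → P x → B} {h : A → C} →
             (∀ {x} (p : P x) → g (f p) ≡ h x) → ∀ {xs} (pxs : All P xs) → map g (All.reduce f pxs) ≡ map h xs
map-reduce g eq []        = refl
map-reduce g eq (p ∷ pxs) = cong₂ _∷_ (eq p) (map-reduce g eq pxs)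

length-reduce : ∀ {P : Pred A 0ℓ} {f : ∀ {x} → P x → B} {xs} (pxs : All P xs) → length (All.reduce f pxs) ≡ length xs
length-reduce []        = refl
length-reduce (p ∷ pxs) = cong suc (length-reduce pxs)

order-units : ∀ n .{{_ : NonZero n}} → PermutationGroup.order (𝒰 n) ≡ length (units n)
order-units n = length-reduce (All.all-filter (isUnit? n) (allFin n))

-- Gives a name to the coefficient that `cycleIndex` keeps in a local definition.
weight : ∀ {N} → PermutationGroup N → ℚ
weight G = (ℤ.+ 1 ℚ./ PermutationGroup.order G) {{PermutationGroup.order≢0 G}}

cycleIndex-map : ∀ {N} (G : PermutationGroup N) →
                 cycleIndex G ≡ map (λ π → weight G , ctype π) (PermutationGroup.elements G)
cycleIndex-map G = refl

map-unitPerms : ∀ n .{{_ : NonZero n}} (w : ℚ) →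
                map (λ π → w , ctype π) (unitPerms n) ≡ map (λ a → w , unitCtype n a) (units n)
map-unitPerms n w = map-reduce {P = IsUnit n} (λ π → w , ctype π) {λ {a} → mulPerm n a}
  (λ {a} c → cong (w ,_) (sym (unitCtype-mulPerm n a c))) (All.all-filter (isUnit? n) (allFin n))

cycleIndex-units : ∀ n .{{_ : NonZero n}} →
                   cycleIndex (𝒰 n) ≡ map (λ a → weight (𝒰 n) , unitCtype n a) (units n)
cycleIndex-units n = trans (cycleIndex-map (𝒰 n)) (map-unitPerms n (weight (𝒰 n)))

-- Division in ℚ normalises. The product is therefore computed with unnormalised fractions, where
-- both sides are the same fraction, and carried back by injectivity of `toℚᵘ`.
1/-* : ∀ a b c .{{_ : NonZero a}} .{{_ : NonZero b}} .{{_ : NonZero c}} → c ≡ a * b →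
       ℤ.+ 1 ℚ./ c ≡ (ℤ.+ 1 ℚ./ a) ℚ.* (ℤ.+ 1 ℚ./ b)
1/-* (suc a) (suc b) _ refl = ℚ.toℚᵘ-injective (begin
  ℚ.toℚᵘ (ℚ.fromℚᵘ (p ℚᵘ.* q))                                ≈⟨ ℚ.toℚᵘ-fromℚᵘ (p ℚᵘ.* q) ⟩
  p ℚᵘ.* q                                                    ≈⟨ ℚᵘ.*-cong (ℚ.toℚᵘ-fromℚᵘ p) (ℚ.toℚᵘ-fromℚᵘ q) ⟨
  ℚ.toℚᵘ (ℚ.fromℚᵘ p) ℚᵘ.* ℚ.toℚᵘ (ℚ.fromℚᵘ q)                ≈⟨ ℚ.toℚᵘ-homo-* (ℚ.fromℚᵘ p) (ℚ.fromℚᵘ q) ⟨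
  ℚ.toℚᵘ (ℚ.fromℚᵘ p ℚ.* ℚ.fromℚᵘ q)                          ∎)
  where
  open import Relation.Binary.Reasoning.Setoid ℚᵘ.≃-setoid
  p q : ℚᵘ.ℚᵘ
  -- `mkℚᵘ` stores the denominator minus one, so this is 1 / (a + 1).
  p = ℚᵘ.mkℚᵘ (ℤ.+ 1) a
  q = ℚᵘ.mkℚᵘ (ℤ.+ 1) b

module _ (m k : ℕ) .{{_ : NonZero m}} .{{_ : NonZero k}} .{{_ : NonZero (m * k)}} (coprime : Coprime m k) where

  open ChineseRemainder m k coprime

  private
    φ : Fin (m * k) → Fin m
    φ = residue m

    ψ : Fin (m * k) → Fin k
    ψ = residue k

  -- The Chinese remainder bijection restricts to units, because a residue is coprime to m k exactly
  -- when it is coprime to m and to k.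
  units↭ : map < φ , ψ > (units (m * k)) ↭ cartesianProduct (units m) (units k)
  units↭ = unique⇒↭
    (unique-map⁺ (λ _ _ eq → residues-injective (cong proj₁ eq) (cong proj₂ eq)) (unique-units (m * k)))
    (Unique.cartesianProduct⁺ (unique-units m) (unique-units k))
    to from
    where
    to : ∀ {p} → p ∈ map < φ , ψ > (units (m * k)) → p ∈ cartesianProduct (units m) (units k)
    to p∈ with c , c∈ , refl ← ∈-map⁻ < φ , ψ > p∈ =
      ∈-cartesianProduct⁺ (residue-units⁺ m (m∣m*n k) c∈) (residue-units⁺ k (n∣m*n m) c∈)

    from : ∀ {p} → p ∈ cartesianProduct (units m) (units k) → p ∈ map < φ , ψ > (units (m * k))
    from {u , v} p∈ =
      let u∈ , v∈ = ∈-cartesianProduct⁻ (units m) (units k) p∈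
          c , c≡u , c≡v = residues-surjective u v
          c-m = residue-units⁻ m c (subst (_∈ units m) (sym c≡u) u∈)
          c-k = residue-units⁻ k c (subst (_∈ units k) (sym c≡v) v∈)
      in subst (_∈ map < φ , ψ > (units (m * k))) (cong₂ _,_ c≡u c≡v)
        (∈-map⁺ < φ , ψ > (∈-units⁺ (Coprime.sym (coprime-* (Coprime.sym c-m) (Coprime.sym c-k)))))

  -- Comparing lengths along `units↭` gives the multiplicativity of Euler's totient; taking
  -- reciprocals gives the claim.
  weight-* : weight (𝒰 (m * k)) ≡ weight (𝒰 m) ℚ.* weight (𝒰 k)
  weight-* = 1/-* _ _ _ {{order≢0 (𝒰 m)}} {{order≢0 (𝒰 k)}} {{order≢0 (𝒰 (m * k))}} (begin
    order (𝒰 (m * k))                            ≡⟨ order-units (m * k) ⟩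
    length (units (m * k))                       ≡⟨ List.length-map < φ , ψ > (units (m * k)) ⟨
    length (map < φ , ψ > (units (m * k)))       ≡⟨ ↭.↭-length units↭ ⟩
    length (cartesianProduct (units m) (units k)) ≡⟨ length-cartesianProduct (units m) (units k) ⟩
    length (units m) * length (units k)          ≡⟨ cong₂ _*_ (order-units m) (order-units k) ⟨
    order (𝒰 m) * order (𝒰 k)                    ∎)
    where
    open ≡-Reasoning
    open PermutationGroup using (order; order≢0)

  -- Reduction modulo `m` and `k` carries multiplication by `c` to multiplication by the residues of
  -- `c`, so `ctype-⊛ᴹ` applies.
  unitCtype-⊛ᴹ : ∀ {c} → c ∈ units (m * k) → unitCtype (m * k) c ≈ᴹ unitCtype m (φ c) ⊛ᴹ unitCtype k (ψ c)
  unitCtype-⊛ᴹ {c} c∈ i = begin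
    exponent (unitCtype (m * k) c) i                   ≡⟨ cong (λ M → exponent M i) (unitCtype-mulPerm (m * k) c c-mk) ⟩
    exponent (ctype π) i                               ≡⟨ ctype-⊛ᴹ π σ τ φ ψ residues-injective residues-surjective
                                                            (λ x → hom m (m∣m*n k) x c-mk c-m) (λ x → hom k (n∣m*n m) x c-mk c-k) i ⟩
    exponent (ctype σ ⊛ᴹ ctype τ) i                    ≡⟨ cong₂ (λ M N → exponent (M ⊛ᴹ N) i) (unitCtype-mulPerm m (φ c) c-m) (unitCtype-mulPerm k (ψ c) c-k) ⟨
    exponent (unitCtype m (φ c) ⊛ᴹ unitCtype k (ψ c)) i ∎
    where
    open ≡-Reasoning
    c-mk : IsUnit (m * k) c
    c-mk = coprime⇒gcd≡1 (∈-units⁻ c∈)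

    c-m : IsUnit m (φ c)
    c-m = coprime⇒gcd≡1 (∈-units⁻ (residue-units⁺ m (m∣m*n k) c∈))

    c-k : IsUnit k (ψ c)
    c-k = coprime⇒gcd≡1 (∈-units⁻ (residue-units⁺ k (n∣m*n m) c∈))

    π = mulPerm (m * k) c c-mk
    σ = mulPerm m (φ c) c-m
    τ = mulPerm k (ψ c) c-k

    hom : ∀ d .{{_ : NonZero d}} → d ∣ m * k → ∀ x u v →
          residue d (mulPerm (m * k) c u ⟨$⟩ʳ x) ≡ mulPerm d (residue d c) v ⟨$⟩ʳ residue d x
    hom d d∣mk x u v = begin
      residue d (mulPerm (m * k) c u ⟨$⟩ʳ x)              ≡⟨ cong (residue d) (mulPerm-to (m * k) c u x) ⟩
      residue d (mulMod (m * k) (toℕ c) x)                ≡⟨ residue-mulMod d d∣mk c x ⟩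
      mulMod d (toℕ (residue d c)) (residue d x)          ≡⟨ mulPerm-to d (residue d c) v (residue d x) ⟨
      mulPerm d (residue d c) v ⟨$⟩ʳ residue d x          ∎

  cycleIndex-* : cycleIndex (𝒰 (m * k)) ↭ᴾ cycleIndex (𝒰 m) ⊛ cycleIndex (𝒰 k)
  cycleIndex-* = begin
    cycleIndex (𝒰 (m * k))
      ≡⟨ cycleIndex-units (m * k) ⟩
    map (λ c → weight (𝒰 (m * k)) , unitCtype (m * k) c) (units (m * k))
      ↭⟨ ↭ᴾ.refl (map-pointwise (units (m * k)) λ c∈ → term≈ weight-* (unitCtype-⊛ᴹ c∈)) ⟩
    map (term ∘ < φ , ψ >) (units (m * k))
      ≡⟨ List.map-∘ (units (m * k)) ⟩
    map term (map < φ , ψ > (units (m * k)))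
      -- Units modulo m k come in increasing order, pairs in lexicographic order; this is the only
      -- genuine reordering.
      ↭⟨ ↭.↭⇒↭ₛ′ (Setoid.isEquivalence termSetoid) (↭.map⁺ term units↭) ⟩
    map term (cartesianProduct (units m) (units k))
      ≡⟨ map-cartesianProduct term (units m) (units k) ⟩
    cartesianProductWith (λ u v → term (u , v)) (units m) (units k)
      ≡⟨ cartesianProductWith-map _ _ _ (units m) (units k) ⟨
    map (λ u → weight (𝒰 m) , unitCtype m u) (units m) ⊛ map (λ v → weight (𝒰 k) , unitCtype k v) (units k)
      ≡⟨ cong₂ _⊛_ (cycleIndex-units m) (cycleIndex-units k) ⟨
    cycleIndex (𝒰 m) ⊛ cycleIndex (𝒰 k) ∎
    where
    open ↭ᴾ.PermutationReasoning
    term : Fin m × Fin k → ℚ × Monomial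
    term (u , v) = weight (𝒰 m) ℚ.* weight (𝒰 k) , unitCtype m u ⊛ᴹ unitCtype k v

-- Z is n ↦ cycleIndex (𝒰 n), kept abstract so that its instances are never unfolded and compared.
module _ (Z : ∀ n → .(NonZero n) → Polynomial)
         (Z-* : ∀ m k .{{m≢0 : NonZero m}} .{{k≢0 : NonZero k}} .{{mk≢0 : NonZero (m * k)}} →
                Coprime m k → Z (m * k) mk≢0 ↭ᴾ Z m m≢0 ⊛ Z k k≢0) where

  Z-cong : ∀ {m n} .(m≢0 : NonZero m) .(n≢0 : NonZero n) → m ≡ n → Z m m≢0 ≡ Z n n≢0
  Z-cong _ _ refl = refl

  -- Here `m` is the product of the factors already folded in and `P` their accumulated `⊛`-product;
  -- each step moves `q zero` into `m`. With `n` kept apart, reassociating the product changes only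
  -- the equation for `n`.
  multiplicative-foldl : ∀ {s} (q : Fin s → ℕ) (q≢0 : ∀ i → NonZero (q i)) →
    (∀ {i j} → i ≢ j → Coprime (q i) (q j)) →
    ∀ m .(m≢0 : NonZero m) → (∀ i → Coprime m (q i)) →
    ∀ n .(n≢0 : NonZero n) → n ≡ m * product (List.tabulate q) →
    ∀ {P} → Z m m≢0 ↭ᴾ P →
    Z n n≢0 ↭ᴾ Vec.foldl (λ _ → Polynomial) _⊛_ P (Vec.tabulate (λ i → Z (q i) (q≢0 i)))
  multiplicative-foldl {zero} q q≢0 cop m m≢0 copᵐ n n≢0 n≡ Zm↭P =
    ↭ᴾ.trans (↭ᴾ.↭-reflexive (Z-cong n≢0 m≢0 (trans n≡ (ℕ.*-identityʳ m)))) Zm↭P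
  multiplicative-foldl {suc s} q q≢0 cop m m≢0 copᵐ n n≢0 n≡ Zm↭P =
    multiplicative-foldl (q ∘ suc) (q≢0 ∘ suc) (λ i≢j → cop (i≢j ∘ Fin.suc-injective))
      (m * q zero) mq≢0 (λ i → coprime-* (copᵐ (suc i)) (cop λ ()))
      n n≢0 (trans n≡ (sym (ℕ.*-assoc m (q zero) _)))
      (↭ᴾ.trans (Z-* m (q zero) {{m≢0}} {{q≢0 zero}} {{mq≢0}} (copᵐ zero))
        (⊛-congˡ (Z (q zero) (q≢0 zero)) Zm↭P))
    where
    mq≢0 : NonZero (m * q zero)
    mq≢0 = ℕ.m*n≢0 m (q zero) {{m≢0}} {{q≢0 zero}}

  -- The fold starts from the first factor, which is its own accumulated product.
  multiplicative-foldl₁ : ∀ {s} (q : Fin (suc s) → ℕ) (q≢0 : ∀ i → NonZero (q i)) →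
    (∀ {i j} → i ≢ j → Coprime (q i) (q j)) →
    ∀ n .(n≢0 : NonZero n) → n ≡ product (List.tabulate q) →
    Z n n≢0 ↭ᴾ Vec.foldl₁ _⊛_ (Vec.tabulate (λ i → Z (q i) (q≢0 i)))
  multiplicative-foldl₁ q q≢0 cop n n≢0 n≡ = multiplicative-foldl (q ∘ suc) (q≢0 ∘ suc)
    (λ i≢j → cop (i≢j ∘ Fin.suc-injective)) (q zero) (q≢0 zero) (λ i → cop λ ()) n n≢0 n≡ ↭ᴾ.↭-refl

-- Distinct prime powers and the theorem

coprime-primes : ∀ {p q} → Prime p → Prime q → p ≢ q → Coprime p q
coprime-primes {p} {q} pp pq p≢q (d∣p , d∣q) with prime⇒irreducible pp d∣p | prime⇒irreducible pq d∣q
... | inj₁ d≡1 | _        = d≡1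
... | inj₂ _   | inj₁ d≡1 = d≡1
... | inj₂ d≡p | inj₂ d≡q = contradiction (trans (sym d≡p) d≡q) p≢q

coprime-^ˡ : ∀ {m k} i → Coprime m k → Coprime (m ^ i) k
coprime-^ˡ zero    c = Coprime.1-coprimeTo _
coprime-^ˡ (suc i) c = coprime-* c (coprime-^ˡ i c)

mainTheorem4 : ∀ (s : ℕ) (p α : Fin (suc s) → ℕ) →
    (prime : ∀ i → Prime (p i)) →
    Injective _≡_ _≡_ p →
    (∀ i → 1 ≤ α i) →
    ∀ (n : ℕ) .{{_ : NonZero n}} →
    n ≡ product (List.tabulate (λ i → p i ^ α i)) →
    cycleIndex (𝒰 n) ≈ᴾ
    Vec.foldl₁ _⊛_ (Vec.tabulate (λ i → cycleIndex (𝒰 (p i ^ α i) {{prime^≢0 (prime i) (α i)}})))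
mainTheorem4 s p α prime injective _ n {{n≢0}} n≡ = ↭ᴾ⇒≈ᴾ
  (multiplicative-foldl₁ (λ n n≢0 → cycleIndex (𝒰 n {{n≢0}})) (λ m k → cycleIndex-* m k)
    (λ i → p i ^ α i) (λ i → prime^≢0 (prime i) (α i)) coprime n n≢0 n≡)
  where
  coprime : ∀ {i j} → i ≢ j → Coprime (p i ^ α i) (p j ^ α j)
  -- `coprime-^ˡ` raises only the left argument to a power, so the pair is flipped between its two
  -- uses and the primes enter in the order `p j`, `p i`.
  coprime {i} {j} i≢j = coprime-^ˡ (α i) (Coprime.sym (coprime-^ˡ (α j)
    (coprime-primes (prime j) (prime i) (i≢j ∘ sym ∘ injective))))
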